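{- Let $n,d$ be positive integers with $n-d\ge1$, and let $\mathcal{Q}_{n,d}$ be the map from $\mathrm{SYT}(d,1^{n-d})\times\{0,1,\dots,n-d-1\}$ to $\widetilde{\mathrm{Sch}}_{n,d-1,(1)}$ defined by $\mathcal{Q}_{n,d}(\tau,i)=\Pi_{n,d-1}^i(\mathcal{S}_{n,d}(\tau))$. Then $\mathcal{Q}_{n,d}$ is a bijection. Moreover, $\mathrm{bounce}(\mathcal{Q}_{n,d}(\tau,i))=\mathrm{maj}(\tau)-\mathrm{des}(\tau)+i$ for all $\tau\in\mathrm{SYT}(d,1^{n-d})$ and all $i\in\{0,1,\dots,n-d-2\}$.
   Context: Words in $N=(0,1)$, $E=(1,0)$, $D=(1,1)$ are read as lattice paths starting at $(0,0)$. $\mathrm{Sch}_{n,d}$ is the set of Schröder paths with $d$ diagonal steps: words with $n-d$ $N$'s, $n-d$ $E$'s and $d$ $D$'s with $|\omega|_N\ge|\omega|_E$ for every prefix $\omega$. A Dyck path is a Schröder path without $D$. The area is the number of lower triangles (lower halves of unit squares cut along the diagonal from bottom left to top right corner) under the path and above the main diagonal; equivalently the sum of $y-x$ over all $N$ and $D$ steps, $(x,y)$ being the starting point of the step. $\widetilde{\mathrm{Sch}}_{n,d}$ is the set of $\gamma\in\mathrm{Sch}_{n,d}$ with no $D$ after the last $N$ (i.e. ending with $NE^k$, $k\ge1$), and $\widetilde{\mathrm{Sch}}_{n,d,(1)}$ is the set of those of area $1$. Such a path is a concatenation of blocks, exactly one of which is $NNEE$ or $NDE$ and all others $NE$ or $D$,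 the last block being $NE$ or $NNEE$. $\{NE,D\}^*$ is the set of all concatenations of blocks $NE$ and $D$, and $\{NE,D\}^*NE$ those whose last block is $NE$. Bounce: for a Dyck path of size $k$ ($k$ north steps), the bounce path starts at $(0,0)$, goes north until it reaches the starting point of an east step of the Dyck path, then east until it reaches the main diagonal, then north again, and so on until $(k,k)$; its bounce is the sum of $k-j$ over all points $(j,j)$, $1\le j\le k$, at which the bounce path returns to the main diagonal. For a Schröder path $\gamma$, let $\Gamma(\gamma)$ be the Dyck path obtained by deleting all $D$ steps. The points where the bounce path of $\Gamma(\gamma)$ turns from north to east are starting points of east steps of $\Gamma(\gamma)$; the corresponding east steps of $\gamma$ are the peak steps. $\mathrm{numph}(\gamma)$ is the sum over all $D$ steps of the number of peak steps preceding that $D$ step in the word, and $\mathrm{bounce}(\gamma)=\mathrm{bounce}(\Gamma(\gamma))+\mathrm{numph}(\gamma)$. $\mathrm{SYT}(\lambda)$: standard Young tableaux of shape $\lambda$ (French notation). $\mathrm{Des}(\tau)$ is the set of entries $i$ with $i+1$ in a strictly higher row; $\mathrm{des}(\tau)=|\mathrm{Des}(\tau)|$ and $\mathrm{maj}(\tau)=\sum_{i\in\mathrm{Des}(\tau)}i$. For $\tau\in\mathrm{SYT}(d,1^{n-d})$, $\mathcal{S}_{n,d}(\tau)=\gamma_\tau=\gamma_1\gamma_2\cdots\gamma_{n-1}$, where for $1\le i\le n-1$: $\gamma_{n-i}=NNEE$ if $i=\max\mathrm{Des}(\tau)$ and $1\in\mathrm{Des}(\tau)$; $\gamma_{n-i}=NDE$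 if $i=\max\mathrm{Des}(\tau)$ and $1\notin\mathrm{Des}(\tau)$; otherwise $\gamma_{n-i}=NE$ if $i=1$ or $i\in\mathrm{Des}(\tau)$; and $\gamma_{n-i}=D$ if $i\notin\mathrm{Des}(\tau)\cup\{1\}$. (If $\mathrm{Des}(\tau)=\{1\}$, the first rule applies to $i=1$.) The map $\Pi_{n,d-1}:\widetilde{\mathrm{Sch}}_{n,d-1,(1)}\to\widetilde{\mathrm{Sch}}_{n,d-1,(1)}$ is the identity if $n-d=1$; if $n-d\ge2$ it is given, for $u\in\{NE,D\}^*$, $v\in\{NE,D\}^*NE$, $i,j\ge0$, by - $uNNEED^jNEv\mapsto uNED^jNNEEv$, - $uNDED^jNEv\mapsto uNED^jNDEv$, - $uNNEED^jNE\mapsto uNED^jNNEE$, - $D^iNEuD^jNNEE\mapsto D^iNNEEuD^jNE$, - $D^iNEuNDED^jNE\mapsto D^iNDEuNED^jNE$. -}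

module Defs where

open import Data.Bool.Base using (if_then_else_; _∨_)
open import Data.Fin.Base using (Fin; toℕ)
open import Data.List.Base
  using (List; []; _∷_; [_]; _++_; _∷ʳ_; concat; concatMap; downFrom; filter; length; map; replicate)
open import Data.List.Extrema.Nat using (max; argmax-sel; v≤max⁺)
import Data.List.Membership.DecPropositional
open import Data.List.Membership.Propositional using (_∈_; _∉_; lose)
open import Data.List.Membership.Propositional.Properties
  using (∈-++⁺ʳ; ∈-++⁻; ∈-map⁺; ∈-map⁻; ∈-filter⁺; ∈-filter⁻; ∈-downFrom⁺; ∈-downFrom⁻)
open import Data.List.Properties
  using (++-assoc; ++-identityʳ; ∷ʳ-injectiveʳ; ∷ʳ-injectiveˡ; length-++; filter-++; filter-accept; filter-reject; filter-all; filter-none; concat-map-[_]; ∷-injectiveˡ; ∷-injectiveʳ)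
open import Data.List.Relation.Binary.Permutation.Propositional using (_↭_; ↭-sym; ↭⇒↭ₛ)
open import Data.List.Relation.Binary.Permutation.Propositional.Properties using (∈-resp-↭; ↭-length; filter-↭)
open import Data.List.Relation.Binary.Permutation.Setoid.Properties using (Unique-resp-↭)
open import Data.List.Relation.Binary.Prefix.Heterogeneous using (Prefix; []; _∷_)
open import Data.List.Relation.Unary.All as All using (All; []; _∷_)
open import Data.List.Relation.Unary.AllPairs using (AllPairs; []; _∷_)
open import Data.List.Relation.Unary.Any using (here; there)
open import Data.List.Relation.Unary.Linked using (Linked; []; [-]; _∷_)
open import Data.List.Relation.Unary.Linked.Properties using (Linked⇒AllPairs)
open import Data.List.Relation.Unary.Unique.Propositional using (Unique)
open import Data.List.Relation.Unary.Unique.Propositional.Properties using (map⁺; downFrom⁺)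
open import Data.Nat.Base using (ℕ; zero; suc; pred; _+_; _∸_; _≤_; _<_; _>_; z≤n; s≤s; s≤s⁻¹)
open import Data.Nat.GeneralisedArithmetic using (iterate)
open import Data.Nat.ListAction using (sum)
open import Data.Nat.Properties
open import Data.Nat.Solver using (module +-*-Solver)
open import Data.Product.Base using (Σ; ∃; ∃₂; _×_; _,_; proj₁; proj₂)
open import Data.Sum.Base using (_⊎_; inj₁; inj₂)
open import Relation.Binary.Definitions using (DecidableEquality)
open import Relation.Binary.PropositionalEquality hiding ([_])
open import Relation.Nullary.Decidable using (dec-true; dec-false)
open import Relation.Unary using (Pred; Decidable)
open import Level using (0ℓ)
open import Relation.Nullary using (¬_; Dec; yes; no; does; ¬?; contradiction)

open Data.List.Membership.DecPropositional _≟_ using (_∈?_)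

data Step : Set where
  N E D : Step

_≟ˢ_ : DecidableEquality Step
N ≟ˢ N = yes refl
N ≟ˢ E = no λ ()
N ≟ˢ D = no λ ()
E ≟ˢ N = no λ ()
E ≟ˢ E = yes refl
E ≟ˢ D = no λ ()
D ≟ˢ N = no λ ()
D ≟ˢ E = no λ ()
D ≟ˢ D = yes refl

Word : Set
Word = List Step

count : Step → Word → ℕ
count s w = length (filter (s ≟ˢ_) w)

record IsSchröder (n d : ℕ) (γ : Word) : Set where
  field
    norths    : count N γ + d ≡ n
    easts     : count E γ + d ≡ n
    diagonals : count D γ ≡ d
    prefixes  : ∀ ω ω′ → γ ≡ ω ++ ω′ → count E ω ≤ count N ω

-- The sum of y - x over the starting points (x , y) of the N and D steps.
-- The subtraction is never truncated on Schröder paths.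
areaFrom : (x y : ℕ) → Word → ℕ
areaFrom x y []      = 0
areaFrom x y (N ∷ w) = (y ∸ x) + areaFrom x (suc y) w
areaFrom x y (E ∷ w) = areaFrom (suc x) y w
areaFrom x y (D ∷ w) = (y ∸ x) + areaFrom (suc x) (suc y) w

area : Word → ℕ
area = areaFrom 0 0

EndsInNE⁺ : Word → Set
EndsInNE⁺ γ = ∃₂ λ ω k → γ ≡ ω ++ N ∷ replicate (suc k) E

record Sch~₁ (n d : ℕ) : Set where
  field
    word       : Word
    isSchröder : IsSchröder n d word
    endsInNE⁺  : EndsInNE⁺ word
    area≡1     : area word ≡ 1

open Sch~₁ public using (word)

Γ : Word → Word
Γ = filter (λ s → ¬? (s ≟ˢ D))

-- The points at which the bounce path of a Dyck path turns from north to
-- east.  Here (x , y) is the current point of the Dyck path and (b , b) the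
-- latest point at which the bounce path has left the diagonal.  From there the
-- bounce path runs north along the line x = b until it meets the starting
-- point (b , y) of the only east step of the Dyck path starting on that line;
-- it then runs east and returns to the diagonal at (y , y).
turnsFrom : (x y b : ℕ) → Word → List (ℕ × ℕ)
turnsFrom x y b []      = []
turnsFrom x y b (N ∷ w) = turnsFrom x (suc y) b w
turnsFrom x y b (E ∷ w) =
  if does (x ≟ b) then (x , y) ∷ turnsFrom (suc x) y y w
                  else turnsFrom (suc x) y b w
turnsFrom x y b (D ∷ w) = turnsFrom (suc x) (suc y) b w

turns : Word → List (ℕ × ℕ)
turns = turnsFrom 0 0 0

bounceDyck : Word → ℕ
bounceDyck π = sum (map (λ (x , y) → count N π ∸ y) (turns π))

-- The east step of Γ γ starting on the line x = e is the (e + 1)-st east step,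
-- and the one of γ corresponding to it is again the (e + 1)-st.  Hence, if e
-- east steps of γ precede a D step, the peak steps preceding that D step are
-- those that correspond to the turning points (x , y) of Γ γ with x < e.
numphFrom : List (ℕ × ℕ) → (e : ℕ) → Word → ℕ
numphFrom ps e []      = 0
numphFrom ps e (N ∷ w) = numphFrom ps e w
numphFrom ps e (E ∷ w) = numphFrom ps (suc e) w
numphFrom ps e (D ∷ w) = length (filter (λ (x , y) → x <? e) ps) + numphFrom ps e w

numph : Word → ℕ
numph γ = numphFrom (turns (Γ γ)) 0 γ

bounce : Word → ℕ
bounce γ = bounceDyck (Γ γ) + numph γ

countdown : ℕ → List ℕ
countdown n = map suc (downFrom n)

-- French notation: the rows are listed from bottom to top.  The Prefix relation
-- compares a row entry by entry with the beginning of the row below it.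
record SYT (shape : List ℕ) : Set where
  field
    rows     : List (List ℕ)
    lengths  : map length rows ≡ shape
    standard : concat rows ↭ countdown (sum shape)
    rows-<   : All (Linked _<_) rows
    cols-<   : Linked (λ lower upper → Prefix _>_ upper lower) rows

open SYT public using (rows)

rowOf : List (List ℕ) → ℕ → ℕ
rowOf []       i = 0
rowOf (r ∷ rs) i = if does (i ∈? r) then 0 else suc (rowOf rs i)

Descent : List (List ℕ) → ℕ → Set
Descent rs i = rowOf rs i < rowOf rs (suc i)

descent? : ∀ rs i → Dec (Descent rs i)
descent? rs i = rowOf rs i <? rowOf rs (suc i)

Des : ∀ {shape} → SYT shape → List ℕ
Des {shape} τ = filter (descent? (rows τ)) (countdown (sum shape ∸ 1))

des : ∀ {shape} → SYT shape → ℕ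
des τ = length (Des τ)

-- Descents are positive, so des τ ≤ maj τ and maj τ ∸ des τ is not truncated.
maj : ∀ {shape} → SYT shape → ℕ
maj τ = sum (Des τ)

hook : (n d : ℕ) → List ℕ
hook n d = d ∷ replicate (n ∸ d) 1

NE NDE NNEE : Word
NE   = N ∷ E ∷ []
NDE  = N ∷ D ∷ E ∷ []
NNEE = N ∷ N ∷ E ∷ E ∷ []

D^_ : ℕ → Word
D^ j = replicate j D

γ-block : (Ds : List ℕ) → ℕ → Word
γ-block Ds i =
  if does (i ≟ max 0 Ds) then (if does (1 ∈? Ds) then NNEE else NDE)
  else if does (i ≟ 1) ∨ does (i ∈? Ds) then NE
  else [ D ]

-- The block γ_{n-i} is γ-block (Des τ) i, so i runs from n - 1 down to 1.
γ-word : ∀ n {shape} → SYT shape → Word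
γ-word n τ = concatMap (γ-block (Des τ)) (countdown (n ∸ 1))

data [NE,D]* : Word → Set where
  []   : [NE,D]* []
  NE∷_ : ∀ {w} → [NE,D]* w → [NE,D]* (NE ++ w)
  D∷_  : ∀ {w} → [NE,D]* w → [NE,D]* (D ∷ w)

[NE,D]*NE : Word → Set
[NE,D]*NE v = ∃ λ v′ → [NE,D]* v′ × v ≡ v′ ++ NE

infix 4 _↦_

-- Rules 1-3 exchange the block NNEE or NDE with the next block NE; if there is
-- no next NE, or only a final one in the case of NDE, rules 4 and 5 exchange it
-- with the first NE.  On Sch~₁ at most one result is possible, although the
-- decomposition u ++ D^ j in rule 4 is not unique.
data _↦_ : Word → Word → Set where
  rule₁ : ∀ {u v} j → [NE,D]* u → [NE,D]*NE v →
          u ++ NNEE ++ D^ j ++ NE ++ v ↦ u ++ NE ++ D^ j ++ NNEE ++ v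
  rule₂ : ∀ {u v} j → [NE,D]* u → [NE,D]*NE v →
          u ++ NDE ++ D^ j ++ NE ++ v ↦ u ++ NE ++ D^ j ++ NDE ++ v
  rule₃ : ∀ {u} j → [NE,D]* u →
          u ++ NNEE ++ D^ j ++ NE ↦ u ++ NE ++ D^ j ++ NNEE
  rule₄ : ∀ {u} i j → [NE,D]* u →
          D^ i ++ NE ++ u ++ D^ j ++ NNEE ↦ D^ i ++ NNEE ++ u ++ D^ j ++ NE
  rule₅ : ∀ {u} i j → [NE,D]* u →
          D^ i ++ NE ++ u ++ NDE ++ D^ j ++ NE ↦ D^ i ++ NDE ++ u ++ NE ++ D^ j ++ NE

-- Path h a w: w leads from height h above the diagonal to the diagonal without
-- crossing it, and has area a.
data Path : (h a : ℕ) → Word → Set where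
  [] : Path 0 0 []
  N∷_ : ∀ {h a w} → Path (suc h) a w → Path h (h + a) (N ∷ w)
  E∷_ : ∀ {h a w} → Path h a w → Path (suc h) a (E ∷ w)
  D∷_ : ∀ {h a w} → Path h a w → Path h (h + a) (D ∷ w)

count-++ : ∀ s v w → count s (v ++ w) ≡ count s v + count s w
count-++ s v w = trans (cong length (filter-++ (s ≟ˢ_) v w)) (length-++ (filter (s ≟ˢ_) v))

path-balanced : ∀ {h a w} → Path h a w → h + count N w ≡ count E w
path-balanced []     = refl
path-balanced {h} (N∷ p) = trans (+-suc h _) (path-balanced p)
path-balanced (E∷ p) = cong suc (path-balanced p)
path-balanced (D∷ p) = path-balanced p

path-prefixes : ∀ {h a w} → Path h a w → ∀ ω ω′ → w ≡ ω ++ ω′ → count E ω ≤ h + count N ω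
path-prefixes p          []      ω′ eq   = z≤n
path-prefixes {h} (N∷ p) (_ ∷ ω) ω′ refl =
  ≤-trans (path-prefixes p ω ω′ refl) (≤-reflexive (sym (+-suc h _)))
path-prefixes (E∷ p)     (_ ∷ ω) ω′ refl = s≤s (path-prefixes p ω ω′ refl)
path-prefixes (D∷ p)     (_ ∷ ω) ω′ refl = path-prefixes p ω ω′ refl

path-area : ∀ {h a w} x → Path h a w → areaFrom x (h + x) w ≡ a
path-area x [] = refl
path-area {h} x (N∷ p) = cong₂ _+_ (m+n∸n≡m h x) (path-area x p)
path-area {suc h} x (E∷_ {w = w} p) =
  trans (cong (λ y → areaFrom (suc x) y w) (sym (+-suc h x))) (path-area (suc x) p)
path-area {h} x (D∷_ {w = w} p) = cong₂ _+_ (m+n∸n≡m h x)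
  (trans (cong (λ y → areaFrom (suc x) y w) (sym (+-suc h x))) (path-area (suc x) p))

toPath : ∀ h x w → h + count N w ≡ count E w →
         (∀ ω ω′ → w ≡ ω ++ ω′ → count E ω ≤ h + count N ω) →
         Path h (areaFrom x (h + x) w) w
toPath h x [] bal pre rewrite m+n≡0⇒m≡0 h bal = []
toPath h x (N ∷ w) bal pre rewrite m+n∸n≡m h x =
  N∷ toPath (suc h) x w (trans (sym (+-suc h _)) bal)
       (λ ω ω′ eq → ≤-trans (pre (N ∷ ω) ω′ (cong (N ∷_) eq)) (≤-reflexive (+-suc h _)))
toPath zero x (E ∷ w) bal pre with () ← pre [ E ] w refl
toPath (suc h) x (E ∷ w) bal pre =
  E∷ subst (λ y → Path h (areaFrom (suc x) y w) w) (+-suc h x)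
       (toPath h (suc x) w (suc-injective bal)
         (λ ω ω′ eq → s≤s⁻¹ (pre (E ∷ ω) ω′ (cong (E ∷_) eq))))
toPath h x (D ∷ w) bal pre rewrite m+n∸n≡m h x =
  D∷ subst (λ y → Path h (areaFrom (suc x) y w) w) (+-suc h x)
       (toPath h (suc x) w bal (λ ω ω′ eq → pre (D ∷ ω) ω′ (cong (D ∷_) eq)))

fromPath : ∀ {n d w} → Path 0 1 w → count N w + d ≡ n → count D w ≡ d → EndsInNE⁺ w → Sch~₁ n d
fromPath {d = d} {w} p ns ds end = record
  { word       = w
  ; isSchröder = record
    { norths    = ns
    ; easts     = trans (cong (_+ d) (sym (path-balanced p))) ns
    ; diagonals = ds
    ; prefixes  = path-prefixes p
    }
  ; endsInNE⁺  = end
  ; area≡1     = path-area 0 p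
  }

*-++ : ∀ {v w} → [NE,D]* v → [NE,D]* w → [NE,D]* (v ++ w)
*-++ []      q = q
*-++ (NE∷ p) q = NE∷ *-++ p q
*-++ (D∷ p)  q = D∷ *-++ p q

*-D^ : ∀ j → [NE,D]* (D^ j)
*-D^ zero    = []
*-D^ (suc j) = D∷ *-D^ j

*-path : ∀ {v a w} → [NE,D]* v → Path 0 a w → Path 0 a (v ++ w)
*-path []      q = q
*-path (NE∷ p) q = N∷ E∷ *-path p q
*-path (D∷ p)  q = D∷ *-path p q

path-* : ∀ {w} → Path 0 0 w → [NE,D]* w
path-* []          = []
path-* (N∷ (E∷ p)) = NE∷ path-* p
path-* (D∷ p)      = D∷ path-* p

data Special : Word → Set where
  nnee : Special NNEE
  nde  : Special NDE

special-path : ∀ {b w} → Special b → Path 0 0 w → Path 0 1 (b ++ w)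
special-path nnee p = N∷ N∷ E∷ E∷ p
special-path nde  p = N∷ D∷ E∷ p

data Blocks : Word → Set where
  blocks : ∀ {u b v} → [NE,D]* u → Special b → [NE,D]* v → Blocks (u ++ b ++ v)

blocks-path : ∀ {u b v} → [NE,D]* u → Special b → [NE,D]* v → Path 0 1 (u ++ b ++ v)
blocks-path p s q = *-path p (special-path s (subst (Path 0 0) (++-identityʳ _) (*-path q [])))

path-blocks : ∀ {w} → Path 0 1 w → Blocks w
path-blocks (N∷ (N∷ (E∷ (E∷ p)))) = blocks [] nnee (path-* p)
path-blocks (N∷ (D∷ (E∷ p)))      = blocks [] nde (path-* p)
path-blocks (N∷ (E∷ p)) with blocks q s r ← path-blocks p = blocks (NE∷ q) s r
path-blocks (D∷ p)      with blocks q s r ← path-blocks p = blocks (D∷ q) s r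

data SnocView : Word → Set where
  empty : SnocView []
  ends-NE : ∀ {w} → [NE,D]* w → SnocView (w ++ NE)
  ends-D  : ∀ {w} → [NE,D]* w → SnocView (w ++ [ D ])

snocView : ∀ {w} → [NE,D]* w → SnocView w
snocView []      = empty
snocView (NE∷ p) with snocView p
... | empty     = ends-NE []
... | ends-NE q = ends-NE (NE∷ q)
... | ends-D q  = ends-D (NE∷ q)
snocView (D∷ p)  with snocView p
... | empty     = ends-D []
... | ends-NE q = ends-NE (D∷ q)
... | ends-D q  = ends-D (D∷ q)

data FirstNE : Word → Set where
  none : ∀ j → FirstNE (D^ j)
  at   : ∀ j {w} → [NE,D]* w → FirstNE (D^ j ++ NE ++ w)

firstNE : ∀ {w} → [NE,D]* w → FirstNE w
firstNE []      = none 0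
firstNE (NE∷ p) = at 0 p
firstNE (D∷ p)  with firstNE p
... | none j = none (suc j)
... | at j q = at (suc j) q

replicate-∷ʳ : ∀ k (s : Step) → replicate (suc k) s ≡ replicate k s ∷ʳ s
replicate-∷ʳ zero    s = refl
replicate-∷ʳ (suc k) s = cong (s ∷_) (replicate-∷ʳ k s)

NE⁺-∷ʳ : ∀ ω k → ω ++ N ∷ replicate (suc k) E ≡ (ω ++ N ∷ replicate k E) ∷ʳ E
NE⁺-∷ʳ ω k = trans (cong (λ z → ω ++ N ∷ z) (replicate-∷ʳ k E)) (sym (++-assoc ω _ [ E ]))

¬end-D : ∀ w → ¬ EndsInNE⁺ (w ∷ʳ D)
¬end-D w (ω , k , eq) with () ← ∷ʳ-injectiveʳ w _ (trans eq (NE⁺-∷ʳ ω k))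

¬end-NDE : ∀ w → ¬ EndsInNE⁺ (w ++ NDE)
¬end-NDE w (ω , k , eq) = last-step k
  (∷ʳ-injectiveˡ _ _ (trans (++-assoc w (N ∷ D ∷ []) [ E ]) (trans eq (NE⁺-∷ʳ ω k))))
  where
  last-step : ∀ k → w ++ N ∷ D ∷ [] ≢ ω ++ N ∷ replicate k E
  last-step zero    eq with () ← ∷ʳ-injectiveʳ (w ∷ʳ N) ω (trans (++-assoc w [ N ] [ D ]) eq)
  last-step (suc k) eq with () ← ∷ʳ-injectiveʳ (w ∷ʳ N) _
                                   (trans (++-assoc w [ N ] [ D ]) (trans eq (NE⁺-∷ʳ ω k)))

end-++ : ∀ v {w} → EndsInNE⁺ w → EndsInNE⁺ (v ++ w)
end-++ v (ω , k , refl) = v ++ ω , k , sym (++-assoc v ω _)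

end-NE : EndsInNE⁺ NE
end-NE = [] , 0 , refl

end-NNEE : EndsInNE⁺ NNEE
end-NNEE = [ N ] , 1 , refl

swap₂₄ : ∀ s u b x c {v} → count s (u ++ c ++ x ++ b ++ v) ≡ count s (u ++ b ++ x ++ c ++ v)
swap₂₄ s u b x c {v} = begin
  # (u ++ c ++ x ++ b ++ v)               ≡⟨ split u c x b ⟩
  # u + (# c + (# x + (# b + # v)))       ≡⟨ solve 5 (λ u c x b v → u :+ (c :+ (x :+ (b :+ v))) := u :+ (b :+ (x :+ (c :+ v)))) refl (# u) (# c) (# x) (# b) (# v) ⟩
  # u + (# b + (# x + (# c + # v)))       ≡⟨ split u b x c ⟨
  # (u ++ b ++ x ++ c ++ v)               ∎
  where
  open ≡-Reasoning
  open +-*-Solver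
  # = count s
  split : ∀ p q r t → # (p ++ q ++ r ++ t ++ v) ≡ # p + (# q + (# r + (# t + # v)))
  split p q r t = trans (count-++ s p _) (cong (# p +_)
    (trans (count-++ s q _) (cong (# q +_)
      (trans (count-++ s r _) (cong (# r +_) (count-++ s t _))))))

↦-count : ∀ s {w w′} → w ↦ w′ → count s w′ ≡ count s w
↦-count s (rule₁ {u} j _ _) = swap₂₄ s u NNEE (D^ j) NE
↦-count s (rule₂ {u} j _ _) = swap₂₄ s u NDE (D^ j) NE
↦-count s (rule₃ {u} j _)   =
  subst₂ (λ x y → count s (u ++ NE ++ D^ j ++ x) ≡ count s (u ++ NNEE ++ D^ j ++ y))
    (++-identityʳ NNEE) (++-identityʳ NE) (swap₂₄ s u NNEE (D^ j) NE {[]})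
↦-count s (rule₄ {u} i j _) =
  subst₂ (λ x y → count s (D^ i ++ NNEE ++ x) ≡ count s (D^ i ++ NE ++ y))
    (++-assoc u (D^ j) NE) (++-assoc u (D^ j) NNEE) (swap₂₄ s (D^ i) NE (u ++ D^ j) NNEE {[]})
↦-count s (rule₅ {u} i j _) = swap₂₄ s (D^ i) NE u NDE

*-NE : ∀ {v} → [NE,D]*NE v → [NE,D]* v
*-NE (v , p , refl) = *-++ p (NE∷ [])

↦-path : ∀ {w w′} → w ↦ w′ → Path 0 1 w′
↦-path (rule₁ j p q)   = *-path p (N∷ E∷ *-path (*-D^ j) (blocks-path [] nnee (*-NE q)))
↦-path (rule₂ j p q)   = *-path p (N∷ E∷ *-path (*-D^ j) (blocks-path [] nde (*-NE q)))
↦-path (rule₃ j p)     = *-path p (N∷ E∷ *-path (*-D^ j) (blocks-path [] nnee []))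
↦-path (rule₄ i j p)   = blocks-path (*-D^ i) nnee (*-++ p (*-++ (*-D^ j) (NE∷ [])))
↦-path (rule₅ i j p)   = blocks-path (*-D^ i) nde (*-++ p (NE∷ *-++ (*-D^ j) (NE∷ [])))

end-*NE : ∀ {v} → [NE,D]*NE v → EndsInNE⁺ v
end-*NE (v , _ , refl) = end-++ v end-NE

↦-end : ∀ {w w′} → w ↦ w′ → EndsInNE⁺ w′
↦-end (rule₁ {u} j p q) = end-++ u (end-++ NE (end-++ (D^ j) (end-++ NNEE (end-*NE q))))
↦-end (rule₂ {u} j p q) = end-++ u (end-++ NE (end-++ (D^ j) (end-++ NDE (end-*NE q))))
↦-end (rule₃ {u} j p)   = end-++ u (end-++ NE (end-++ (D^ j) end-NNEE))
↦-end (rule₄ {u} i j p) = end-++ (D^ i) (end-++ NNEE (end-++ u (end-++ (D^ j) end-NE)))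
↦-end (rule₅ {u} i j p) = end-++ (D^ i) (end-++ NDE (end-++ u (end-++ NE (end-++ (D^ j) end-NE))))

count-D^ : ∀ j → count N (D^ j) ≡ 0
count-D^ zero    = refl
count-D^ (suc j) = count-D^ j

few-norths : ∀ {i b v} → count N b + count N v ≤ 2 → ¬ 3 ≤ count N (D^ i ++ b ++ v)
few-norths {i} {b} {v} bv≤2 3≤ = <⇒≱ (n<1+n 2) (≤-trans 3≤ (≤-trans (≤-reflexive eq) bv≤2))
  where
  eq : count N (D^ i ++ b ++ v) ≡ count N b + count N v
  eq = trans (count-++ N (D^ i) _) (cong₂ _+_ (count-D^ i) (count-++ N b v))

apply-rule : ∀ {w} → Blocks w → EndsInNE⁺ w → 3 ≤ count N w → ∃ λ w′ → w ↦ w′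
apply-rule (blocks {u} {b} p s q) end 3≤ with snocView q
apply-rule (blocks {u} p nde q) end 3≤ | empty =
  contradiction end (¬end-NDE u)
apply-rule (blocks p nnee q) end 3≤ | empty with firstNE p
... | none i = contradiction 3≤ (few-norths {i} {NNEE} ≤-refl)
... | at i {u} r = _ , subst (_↦ D^ i ++ NNEE ++ u ++ NE)
                         (sym (++-assoc (D^ i) (NE ++ u) NNEE)) (rule₄ i 0 r)
apply-rule (blocks {u} {b} p s q) end 3≤ | ends-D {v} r =
  contradiction (subst EndsInNE⁺ eq end) (¬end-D _)
  where
  eq : u ++ b ++ v ++ [ D ] ≡ (u ++ b ++ v) ++ [ D ]
  eq = sym (trans (++-assoc u _ _) (cong (u ++_) (++-assoc b v _)))
apply-rule (blocks {u} p s q) end 3≤ | ends-NE r with firstNE r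
apply-rule (blocks {u} p s q) end 3≤ | ends-NE r | at j {v} r′
  rewrite ++-assoc (D^ j) (NE ++ v) NE with s
... | nnee = _ , rule₁ j p (v , r′ , refl)
... | nde  = _ , rule₂ j p (v , r′ , refl)
apply-rule (blocks p nnee q) end 3≤ | ends-NE r | none j = _ , rule₃ j p
apply-rule (blocks p nde q)  end 3≤ | ends-NE r | none j with firstNE p
... | none i = contradiction 3≤ (few-norths {i} {NDE}
                 (≤-reflexive (cong suc (trans (count-++ N (D^ j) NE) (cong (_+ 1) (count-D^ j))))))
... | at i {u} r′ = _ , subst (_↦ D^ i ++ NDE ++ u ++ NE ++ D^ j ++ NE)
                          (sym (++-assoc (D^ i) (NE ++ u) _)) (rule₅ i j r′)

Π-step : ∀ n e → 2 ≤ n ∸ suc e → (γ : Sch~₁ n e) → ∃ λ (γ′ : Sch~₁ n e) → word γ ↦ word γ′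
Π-step n e 2≤ γ = fromPath (↦-path r) (trans (cong (_+ e) (↦-count N r)) norths)
                           (trans (↦-count D r) diagonals) (↦-end r) , r
  where
  open Sch~₁ γ hiding (word)
  open IsSchröder isSchröder

  path : Path 0 1 (word γ)
  path = subst (λ a → Path 0 a (word γ)) area≡1
    (toPath 0 0 (word γ) (+-cancelʳ-≡ e _ _ (trans norths (sym easts))) prefixes)

  3≤norths : 3 ≤ count N (word γ)
  3≤norths = lift (subst (2 ≤_) (begin
    n ∸ suc e                            ≡⟨ pred[m∸n]≡m∸[1+n] n e ⟨
    pred (n ∸ e)                         ≡⟨ cong (λ m → pred (m ∸ e)) norths ⟨
    pred (count N (word γ) + e ∸ e)      ≡⟨ cong pred (m+n∸n≡m _ e) ⟩
    pred (count N (word γ))              ∎) 2≤)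
    where
    open ≡-Reasoning
    lift : ∀ {m} → 2 ≤ pred m → 3 ≤ m
    lift {suc m} le = s≤s le

  step : ∃ λ w′ → word γ ↦ w′
  step = apply-rule (path-blocks path) endsInNE⁺ 3≤norths

  r : word γ ↦ proj₁ step
  r = proj₂ step

-- Here e is the number d - 1 of diagonal steps, so n ∸ suc e is n - d.
Π : ∀ n e → Sch~₁ n e → Sch~₁ n e
Π n e γ with 2 ≤? n ∸ suc e
... | yes 2≤ = proj₁ (Π-step n e 2≤ γ)
... | no  _  = γ

module _ {A P : Set} {x y : A} (P? : Dec P) where

  if-yes : P → (if does P? then x else y) ≡ x
  if-yes p = cong (if_then x else y) (dec-true P? p)

  if-no : ¬ P → (if does P? then x else y) ≡ y
  if-no ¬p = cong (if_then x else y) (dec-false P? ¬p)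

∈-countdown⁺ : ∀ {i m} → 1 ≤ i → i ≤ m → i ∈ countdown m
∈-countdown⁺ (s≤s _) i≤m = ∈-map⁺ suc (∈-downFrom⁺ i≤m)

∈-countdown⁻ : ∀ {i m} → i ∈ countdown m → 1 ≤ i × i ≤ m
∈-countdown⁻ i∈ with _ , j∈ , refl ← ∈-map⁻ suc i∈ = s≤s z≤n , ∈-downFrom⁻ j∈

data BlockView (Ds : List ℕ) (i : ℕ) : Word → Set where
  first₁  : i ≡ max 0 Ds → 1 ∈ Ds → BlockView Ds i NNEE
  first₂  : i ≡ max 0 Ds → 1 ∉ Ds → BlockView Ds i NDE
  another : i ≢ max 0 Ds → i ≡ 1 ⊎ i ∈ Ds → BlockView Ds i NE
  none    : i ≢ max 0 Ds → i ≢ 1 → i ∉ Ds → BlockView Ds i [ D ]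

blockView : ∀ Ds i → BlockView Ds i (γ-block Ds i)
blockView Ds i = view (i ≟ max 0 Ds) (1 ∈? Ds) (i ≟ 1) (i ∈? Ds)
  where
  view : (p? : Dec (i ≡ max 0 Ds)) (q? : Dec (1 ∈ Ds)) (r? : Dec (i ≡ 1)) (s? : Dec (i ∈ Ds)) →
         BlockView Ds i (if does p? then (if does q? then NNEE else NDE)
                         else if does r? ∨ does s? then NE else [ D ])
  view (yes p) (yes q) r?      s?      = first₁ p q
  view (yes p) (no ¬q) r?      s?      = first₂ p ¬q
  view (no ¬p) q?      (yes r) s?      = another ¬p (inj₁ r)
  view (no ¬p) q?      (no ¬r) (yes s) = another ¬p (inj₂ s)
  view (no ¬p) q?      (no ¬r) (no ¬s) = none ¬p ¬r ¬s

module _ {P : Pred ℕ 0ℓ} (P? : Decidable P) (m : ℕ) where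

  private
    Ds : List ℕ
    Ds = filter P? (countdown m)

    M : ℕ
    M = max 0 Ds

    W : ℕ → Word
    W k = concatMap (γ-block Ds) (countdown k)

    # : ℕ → ℕ
    # k = length (filter P? (countdown k))

  #-yes : ∀ {k} → suc k ∈ Ds → # (suc k) ≡ suc (# k)
  #-yes k∈ = cong length (filter-accept P? (proj₂ (∈-filter⁻ P? {xs = countdown m} k∈)))

  #-no : ∀ {k} → suc k ≤ m → suc k ∉ Ds → # (suc k) ≡ # k
  #-no k≤m k∉ = cong length (filter-reject P? λ p → k∉ (∈-filter⁺ P? (∈-countdown⁺ (s≤s z≤n) k≤m) p))

  ≤M : ∀ {i} → i ∈ Ds → i ≤ M
  ≤M i∈ = v≤max⁺ 0 Ds (inj₂ (lose i∈ ≤-refl))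

  low : ∀ k → suc k < M → [NE,D]*NE (W (suc k))
  low zero 1<M with γ-block Ds 1 | blockView Ds 1
  ... | _ | first₁ 1≡M _  = contradiction 1≡M (<⇒≢ 1<M)
  ... | _ | first₂ 1≡M _  = contradiction 1≡M (<⇒≢ 1<M)
  ... | _ | another _ _   = [] , [] , refl
  ... | _ | none _ 1≢1 _  = contradiction refl 1≢1
  low (suc k) k<M with low k (<⇒≤ k<M) | γ-block Ds (2 + k) | blockView Ds (2 + k)
  ... | _ | _ | first₁ k≡M _ = contradiction k≡M (<⇒≢ k<M)
  ... | _ | _ | first₂ k≡M _ = contradiction k≡M (<⇒≢ k<M)
  ... | v , p , eq | _ | another _ _ = _ , NE∷ p , cong (NE ++_) eq
  ... | v , p , eq | _ | none _ _ _  = _ , D∷ p , cong (D ∷_) eq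

  low-* : ∀ k → k < M → [NE,D]* (W k)
  low-* zero    _   = []
  low-* (suc k) k<M = *-NE (low k k<M)

  low-size : ∀ k → k < M → count N (W k) + count D (W k) ≡ k
  low-size zero    _ = refl
  low-size (suc k) k<M with γ-block Ds (suc k) | blockView Ds (suc k)
  ... | _ | first₁ k≡M _ = contradiction k≡M (<⇒≢ k<M)
  ... | _ | first₂ k≡M _ = contradiction k≡M (<⇒≢ k<M)
  ... | _ | another _ _  = cong suc (low-size k (<⇒≤ k<M))
  ... | _ | none _ _ _   = trans (+-suc _ _) (cong suc (low-size k (<⇒≤ k<M)))

  low-count₁ : 1 ∈ Ds → ∀ k → k < M → k ≤ m → count N (W k) ≡ # k
  low-count₁ 1∈ zero    _   _ = refl
  low-count₁ 1∈ (suc k) k<M k≤m with γ-block Ds (suc k) | blockView Ds (suc k)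
  ... | _ | first₁ k≡M _ = contradiction k≡M (<⇒≢ k<M)
  ... | _ | first₂ k≡M _ = contradiction k≡M (<⇒≢ k<M)
  ... | _ | another _ (inj₁ refl) = trans (cong suc (low-count₁ 1∈ k (<⇒≤ k<M) (<⇒≤ k≤m))) (sym (#-yes 1∈))
  ... | _ | another _ (inj₂ k∈)   = trans (cong suc (low-count₁ 1∈ k (<⇒≤ k<M) (<⇒≤ k≤m))) (sym (#-yes k∈))
  ... | _ | none _ _ k∉           = trans (low-count₁ 1∈ k (<⇒≤ k<M) (<⇒≤ k≤m)) (sym (#-no k≤m k∉))

  low-count₂ : 1 ∉ Ds → ∀ k → suc k < M → suc k ≤ m → count N (W (suc k)) ≡ suc (# (suc k))
  low-count₂ 1∉ zero k<M k≤m with γ-block Ds 1 | blockView Ds 1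
  ... | _ | first₁ k≡M _ = contradiction k≡M (<⇒≢ k<M)
  ... | _ | first₂ k≡M _ = contradiction k≡M (<⇒≢ k<M)
  ... | _ | another _ _  = cong suc (sym (#-no k≤m 1∉))
  ... | _ | none _ 1≢1 _ = contradiction refl 1≢1
  low-count₂ 1∉ (suc k) k<M k≤m with γ-block Ds (2 + k) | blockView Ds (2 + k)
  ... | _ | first₁ k≡M _ = contradiction k≡M (<⇒≢ k<M)
  ... | _ | first₂ k≡M _ = contradiction k≡M (<⇒≢ k<M)
  ... | _ | another _ (inj₂ k∈) = cong suc (trans (low-count₂ 1∉ k (<⇒≤ k<M) (<⇒≤ k≤m)) (sym (#-yes k∈)))
  ... | _ | none _ _ k∉         = trans (low-count₂ 1∉ k (<⇒≤ k<M) (<⇒≤ k≤m)) (cong suc (sym (#-no k≤m k∉)))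

  record Good (k : ℕ) : Set where
    field
      path      : Path 0 1 (W k)
      endsInNE⁺ : EndsInNE⁺ (W k)
      norths    : count N (W k) ≡ suc (# k)
      size      : count N (W k) + count D (W k) ≡ suc k

  module _ (M∈ : M ∈ Ds) where

    M≤m : M ≤ m
    M≤m = proj₂ (∈-countdown⁻ (proj₁ (∈-filter⁻ P? {xs = countdown m} M∈)))

    at-M : ∀ k → M ≡ suc k → Good (suc k)
    at-M k eq = record { path = path′ ; endsInNE⁺ = end′ ; norths = norths′ ; size = size′ }
      where
      k<M : k < M
      k<M = ≤-reflexive (sym eq)

      k≤m : suc k ≤ m
      k≤m = ≤-trans k<M M≤m

      #≡ : # (suc k) ≡ suc (# k)
      #≡ = #-yes (subst (_∈ Ds) eq M∈)

      path′ : Path 0 1 (W (suc k))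
      path′ with γ-block Ds (suc k) | blockView Ds (suc k)
      ... | _ | first₁ _ _     = blocks-path [] nnee (low-* k k<M)
      ... | _ | first₂ _ _     = blocks-path [] nde (low-* k k<M)
      ... | _ | another k≢M _  = contradiction (sym eq) k≢M
      ... | _ | none k≢M _ _   = contradiction (sym eq) k≢M

      end-low : ∀ k → k < M → k ≡ 0 ⊎ EndsInNE⁺ (W k)
      end-low zero    _   = inj₁ refl
      end-low (suc k) k<M = inj₂ (end-*NE (low k k<M))

      end′ : EndsInNE⁺ (W (suc k))
      end′ with γ-block Ds (suc k) | blockView Ds (suc k) | end-low k k<M
      ... | _ | first₁ _ _     | inj₁ refl = end-NNEE
      ... | _ | first₁ _ _     | inj₂ end  = end-++ NNEE end
      ... | _ | first₂ _ 1∉    | inj₁ refl = contradiction (subst (_∈ Ds) eq M∈) 1∉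
      ... | _ | first₂ _ _     | inj₂ end  = end-++ NDE end
      ... | _ | another k≢M _  | _         = contradiction (sym eq) k≢M
      ... | _ | none k≢M _ _   | _         = contradiction (sym eq) k≢M

      norths₂ : 1 ∉ Ds → ∀ k → M ≡ suc k → k < M → k ≤ m → count N (W k) ≡ suc (# k)
      norths₂ 1∉ zero    eq _ _ = contradiction (subst (_∈ Ds) eq M∈) 1∉
      norths₂ 1∉ (suc k) _ k<M k≤m = low-count₂ 1∉ k k<M k≤m

      norths′ : count N (W (suc k)) ≡ suc (# (suc k))
      norths′ with γ-block Ds (suc k) | blockView Ds (suc k)
      ... | _ | first₁ _ 1∈    = cong suc (trans (cong suc (low-count₁ 1∈ k k<M (<⇒≤ k≤m))) (sym #≡))
      ... | _ | first₂ _ 1∉    = cong suc (trans (norths₂ 1∉ k eq k<M (<⇒≤ k≤m)) (sym #≡))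
      ... | _ | another k≢M _  = contradiction (sym eq) k≢M
      ... | _ | none k≢M _ _   = contradiction (sym eq) k≢M

      size′ : count N (W (suc k)) + count D (W (suc k)) ≡ 2 + k
      size′ with γ-block Ds (suc k) | blockView Ds (suc k)
      ... | _ | first₁ _ _     = cong (2 +_) (low-size k k<M)
      ... | _ | first₂ _ _     = cong suc (trans (+-suc _ _) (cong suc (low-size k k<M)))
      ... | _ | another k≢M _  = contradiction (sym eq) k≢M
      ... | _ | none k≢M _ _   = contradiction (sym eq) k≢M

    above-M : ∀ k → M ≤ k → suc k ≤ m → Good k → Good (suc k)
    above-M k M≤k k≤m g with γ-block Ds (suc k) in eq | blockView Ds (suc k)
    ... | _ | first₁ k≡M _ = contradiction (sym k≡M) (<⇒≢ (s≤s M≤k))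
    ... | _ | first₂ k≡M _ = contradiction (sym k≡M) (<⇒≢ (s≤s M≤k))
    ... | _ | another _ (inj₁ refl) =
      contradiction (proj₁ (∈-countdown⁻ (proj₁ (∈-filter⁻ P? {xs = countdown m} M∈)))) (≤⇒≯ M≤k)
    ... | _ | another _ (inj₂ k∈) = contradiction (≤M k∈) (<⇒≱ (s≤s M≤k))
    ... | _ | none _ _ k∉ = record
      { path      = subst (λ b → Path 0 1 (b ++ W k)) (sym eq) (D∷ g.path)
      ; endsInNE⁺ = subst (λ b → EndsInNE⁺ (b ++ W k)) (sym eq) (end-++ [ D ] g.endsInNE⁺)
      ; norths    = subst (λ b → count N (b ++ W k) ≡ suc (# (suc k))) (sym eq)
                      (trans g.norths (cong suc (sym (#-no k≤m k∉))))
      ; size      = subst (λ b → count N (b ++ W k) + count D (b ++ W k) ≡ 2 + k) (sym eq)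
                      (trans (+-suc _ _) (cong suc g.size))
      }
      where module g = Good g

    from-M : ∀ j → j + M ≤ m → Good (j + M)
    from-M zero    _  = subst Good eq (at-M (pred M) (sym eq))
      where
      eq : suc (pred M) ≡ M
      eq = m<n⇒suc-pred (proj₁ (∈-countdown⁻ (proj₁ (∈-filter⁻ P? {xs = countdown m} M∈))))
        where
        m<n⇒suc-pred : ∀ {n} → 1 ≤ n → suc (pred n) ≡ n
        m<n⇒suc-pred (s≤s _) = refl
    from-M (suc j) le = above-M (j + M) (m≤n+m M j) le (from-M j (<⇒≤ le))

    good : Good m
    good = subst Good (m∸n+n≡m M≤m) (from-M (m ∸ M) (≤-reflexive (m∸n+n≡m M≤m)))

  γ-Sch~₁ : ∀ {n d} → m ≡ n ∸ 1 → 1 ≤ d → 1 ≤ n ∸ d → length Ds ≡ n ∸ d →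
            Σ (Sch~₁ n (d ∸ 1)) λ γ → word γ ≡ W (n ∸ 1)
  γ-Sch~₁ {n} {d} refl 1≤d 1≤n∸d len = fromPath g.path norths diagonals g.endsInNE⁺ , refl
    where
    nonempty : ∀ {xs : List ℕ} → 1 ≤ length xs → ∃ λ x → x ∈ xs
    nonempty {x ∷ _} _ = x , here refl

    M∈ : M ∈ Ds
    M∈ with argmax-sel (λ x → x) 0 Ds
    ... | inj₂ M∈  = M∈
    ... | inj₁ M≡0 with x , x∈ ← nonempty (subst (1 ≤_) (sym len) 1≤n∸d) =
      contradiction (subst (x ≤_) M≡0 (≤M x∈))
        (<⇒≱ (proj₁ (∈-countdown⁻ (proj₁ (∈-filter⁻ P? {xs = countdown m} x∈)))))

    module g = Good (good M∈)

    d<n : d < n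
    d<n = m∸n≢0⇒n<m λ eq → contradiction (subst (1 ≤_) eq 1≤n∸d) λ ()

    suc-pred′ : ∀ {k} → 1 ≤ k → suc (k ∸ 1) ≡ k
    suc-pred′ (s≤s _) = refl

    norths : count N (W m) + (d ∸ 1) ≡ n
    norths = begin
      count N (W m) + (d ∸ 1)   ≡⟨ cong (_+ (d ∸ 1)) (trans g.norths (cong suc len)) ⟩
      suc (n ∸ d) + (d ∸ 1)     ≡⟨ +-suc (n ∸ d) (d ∸ 1) ⟨
      n ∸ d + suc (d ∸ 1)       ≡⟨ cong (n ∸ d +_) (suc-pred′ 1≤d) ⟩
      n ∸ d + d                 ≡⟨ m∸n+n≡m (<⇒≤ d<n) ⟩
      n                         ∎
      where open ≡-Reasoning

    diagonals : count D (W m) ≡ d ∸ 1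
    diagonals = +-cancelˡ-≡ (count N (W m)) _ _
      (trans g.size (trans (suc-pred′ (≤-trans 1≤d (<⇒≤ d<n))) (sym norths)))

rowOf-here : ∀ r rs {i} → i ∈ r → rowOf (r ∷ rs) i ≡ 0
rowOf-here r rs {i} i∈ = if-yes (i ∈? r) i∈

rowOf-there : ∀ r rs {i} → i ∉ r → rowOf (r ∷ rs) i ≡ suc (rowOf rs i)
rowOf-there r rs {i} i∉ = if-no (i ∈? r) i∉

descent-from-here : ∀ r rs {i} → i ∈ r → suc i ∉ r → Descent (r ∷ rs) i
descent-from-here r rs i∈ si∉ =
  subst₂ _<_ (sym (rowOf-here r rs i∈)) (sym (rowOf-there r rs si∉)) (s≤s z≤n)

descent-there : ∀ r rs {i} → i ∉ r → suc i ∉ r → Descent rs i → Descent (r ∷ rs) i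
descent-there r rs i∉ si∉ <′ =
  subst₂ _<_ (sym (rowOf-there r rs i∉)) (sym (rowOf-there r rs si∉)) (s≤s <′)

no-descent : ∀ r rs {i} → suc i ∈ r → ¬ Descent (r ∷ rs) i
no-descent r rs si∈ <′ with () ← subst (rowOf (r ∷ rs) _ <_) (rowOf-here r rs si∈) <′

singletons : ∀ cs m → map length cs ≡ replicate m 1 →
             ∃ λ (c : List ℕ) → cs ≡ map [_] c × length c ≡ m
singletons []                   zero    eq = [] , refl , refl
singletons ((x ∷ [])    ∷ cs)   (suc m) eq with c , refl , refl ← singletons cs m (∷-injectiveʳ eq) =
  x ∷ c , refl , refl
singletons ([]          ∷ cs)   (suc m) eq with () ← ∷-injectiveˡ eq
singletons ((_ ∷ _ ∷ _) ∷ cs)   (suc m) eq with () ← ∷-injectiveˡ eq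

column-< : ∀ a as c → Linked (λ lower upper → Prefix _>_ upper lower) ((a ∷ as) ∷ map [_] c) →
           Linked _<_ (a ∷ c)
column-< a as []      _               = [-]
column-< a as (x ∷ c) ((a<x ∷ _) ∷ l) = a<x ∷ column-< x [] c l

column-descent : ∀ {c i} → AllPairs _<_ c → i ∈ c → suc i ∈ c → Descent (map [_] c) i
column-descent {x ∷ c} {i} (x< ∷ <c) i∈ si∈ with i ∈? [ x ] | suc i ∈? [ x ]
... | yes i∈x@(here refl) | no si∉x          = descent-from-here [ x ] (map [_] c) i∈x si∉x
... | no i∉x | yes (here refl)  with i∈
...   | here i≡x  = contradiction (here i≡x) i∉x
...   | there i∈c = contradiction (All.lookup x< i∈c) (<⇒≯ ≤-refl)
column-descent {x ∷ c} {i} (x< ∷ <c) i∈ si∈ | no i∉x | no si∉x =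
  descent-there [ x ] (map [_] c) i∉x si∉x (column-descent <c (drop i∉x i∈) (drop si∉x si∈))
  where
  drop : ∀ {j} → j ∉ [ x ] → j ∈ x ∷ c → j ∈ c
  drop j∉ (here j≡)  = contradiction (here j≡) j∉
  drop j∉ (there j∈) = j∈
column-descent _ _ _ | yes (here refl) | yes (here ())

disjoint : ∀ {xs ys : List ℕ} {z} → Unique (xs ++ ys) → z ∈ xs → z ∉ ys
disjoint {_ ∷ xs} (z≢ ∷ _) (here refl) z∈ys = All.lookup z≢ (∈-++⁺ʳ xs z∈ys) refl
disjoint          (_ ∷ u)  (there z∈)  z∈ys = disjoint u z∈ z∈ys

sum-hook : ∀ {n d} → d ≤ n → sum (hook n d) ≡ n
sum-hook {n} {d} d≤n = trans (cong (d +_) (sum-ones (n ∸ d))) (m+[n∸m]≡n d≤n)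
  where
  sum-ones : ∀ k → sum (replicate k 1) ≡ k
  sum-ones zero    = refl
  sum-ones (suc k) = cong suc (sum-ones k)

module _ (s : ℕ) (a : ℕ) (as c : List ℕ)
         (standard : (a ∷ as) ++ c ↭ countdown s)
         (col-< : Linked _<_ (a ∷ c)) where

  private
    r : List ℕ
    r = a ∷ as

    rs : List (List ℕ)
    rs = r ∷ map [_] c

    ∉r? : Decidable (_∉ r)
    ∉r? j = ¬? (j ∈? r)

  unique : Unique (r ++ c)
  unique = Unique-resp-↭ (setoid ℕ) (↭⇒↭ₛ (↭-sym standard)) (map⁺ suc-injective (downFrom⁺ s))

  entry : ∀ {j} → 1 ≤ j → j ≤ s → j ∈ r ⊎ j ∈ c
  entry 1≤j j≤s = ∈-++⁻ r (∈-resp-↭ (↭-sym standard) (∈-countdown⁺ 1≤j j≤s))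

  1∈r : 1 ≤ s → 1 ∈ r
  1∈r 1≤s with entry ≤-refl 1≤s
  ... | inj₁ 1∈r = 1∈r
  ... | inj₂ 1∈c with a< ∷ _ ← Linked⇒AllPairs <-trans col-< =
    contradiction (All.lookup a< 1∈c)
      (≤⇒≯ (proj₁ (∈-countdown⁻ (∈-resp-↭ standard (here refl)))))

  ∉r⇒descent : ∀ {i} → 1 ≤ i → suc i ≤ s → suc i ∉ r → Descent rs i
  ∉r⇒descent {i} 1≤i i<s si∉ with i ∈? r
  ... | yes i∈ = descent-from-here r (map [_] c) i∈ si∉
  ... | no i∉ with entry 1≤i (<⇒≤ i<s) | entry (s≤s z≤n) i<s | Linked⇒AllPairs <-trans col-<
  ... | inj₂ i∈c | inj₂ si∈c | _ ∷ <c = descent-there r (map [_] c) i∉ si∉ (column-descent <c i∈c si∈c)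
  ... | inj₁ i∈r | _         | _      = contradiction i∈r i∉
  ... | _        | inj₁ si∈r | _      = contradiction si∈r si∉

  shift-descents : ∀ k → suc k ≤ s → length (filter (descent? rs) (countdown k)) ≡
                                     length (filter ∉r? (countdown (suc k)))
  shift-descents zero    1≤s = sym (cong length (filter-reject ∉r? {xs = []} λ 1∉ → 1∉ (1∈r 1≤s)))
  shift-descents (suc k) k<s with (2 + k) ∈? r
  ... | yes k∈ = begin
    length (filter (descent? rs) (countdown (suc k)))  ≡⟨ cong length (filter-reject (descent? rs) (no-descent r (map [_] c) k∈)) ⟩
    length (filter (descent? rs) (countdown k))        ≡⟨ shift-descents k (<⇒≤ k<s) ⟩
    length (filter ∉r? (countdown (suc k)))            ≡⟨ cong length (filter-reject ∉r? (λ k∉ → k∉ k∈)) ⟨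
    length (filter ∉r? (countdown (2 + k)))            ∎
    where open ≡-Reasoning
  ... | no k∉ = begin
    length (filter (descent? rs) (countdown (suc k)))  ≡⟨ cong length (filter-accept (descent? rs) (∉r⇒descent (s≤s z≤n) k<s k∉)) ⟩
    suc (length (filter (descent? rs) (countdown k)))  ≡⟨ cong suc (shift-descents k (<⇒≤ k<s)) ⟩
    suc (length (filter ∉r? (countdown (suc k))))      ≡⟨ cong length (filter-accept ∉r? k∉) ⟨
    length (filter ∉r? (countdown (2 + k)))            ∎
    where open ≡-Reasoning

  column-descents : 1 ≤ s → length (filter (descent? rs) (countdown (s ∸ 1))) ≡ length c
  column-descents 1≤s@(s≤s _) = begin
    length (filter (descent? rs) (countdown (s ∸ 1)))  ≡⟨ shift-descents (s ∸ 1) ≤-refl ⟩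
    length (filter ∉r? (countdown s))                  ≡⟨ ↭-length (filter-↭ ∉r? standard) ⟨
    length (filter ∉r? (r ++ c))                       ≡⟨ cong length (filter-++ ∉r? r c) ⟩
    length (filter ∉r? r ++ filter ∉r? c)              ≡⟨ cong₂ (λ xs ys → length (xs ++ ys))
                                                            (filter-none ∉r? (All.tabulate λ x∈ x∉ → x∉ x∈))
                                                            (filter-all ∉r? (All.tabulate λ x∈c x∈r → disjoint unique x∈r x∈c)) ⟩
    length c                                           ∎
    where open ≡-Reasoning

des-hook : ∀ {n d} → 1 ≤ d → 1 ≤ n → (τ : SYT (hook n d)) → d ≤ n → des τ ≡ n ∸ d
des-hook {n} {d} 1≤d 1≤n τ d≤n with rows τ | SYT.lengths τ | SYT.standard τ | SYT.cols-< τ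
... | (a ∷ as) ∷ cs | eq | st | cols with c , refl , len ← singletons cs (n ∸ d) (∷-injectiveʳ eq) =
  trans (column-descents (sum (hook n d)) a as c
          (subst (λ xs → (a ∷ as) ++ xs ↭ countdown (sum (hook n d))) (concat-map-[_] c) st)
          (column-< a as c cols)
          (≤-trans 1≤n (≤-reflexive (sym (sum-hook d≤n)))))
        len
... | [] ∷ cs | eq | _ | _ = contradiction (subst (1 ≤_) (sym (∷-injectiveˡ eq)) 1≤d) λ ()

𝒮-γ : ∀ n d → 1 ≤ d → 1 ≤ n ∸ d → (τ : SYT (hook n d)) →
       Σ (Sch~₁ n (d ∸ 1)) λ γ → word γ ≡ γ-word n τ
𝒮-γ n d 1≤d 1≤n∸d τ =
  γ-Sch~₁ (descent? (rows τ)) (sum (hook n d) ∸ 1) (cong (_∸ 1) (sum-hook d≤n)) 1≤d 1≤n∸d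
    (des-hook 1≤d (≤-trans 1≤n∸d (m∸n≤m n d)) τ d≤n)
  where
  d≤n : d ≤ n
  d≤n = <⇒≤ (m∸n≢0⇒n<m λ eq → contradiction (subst (1 ≤_) eq 1≤n∸d) λ ())

𝒮 : ∀ n d → 1 ≤ d → 1 ≤ n ∸ d → SYT (hook n d) → Sch~₁ n (d ∸ 1)
𝒮 n d 1≤d 1≤n∸d τ = proj₁ (𝒮-γ n d 1≤d 1≤n∸d τ)

𝒬 : ∀ n d → 1 ≤ d → 1 ≤ n ∸ d → SYT (hook n d) × Fin (n ∸ d) → Sch~₁ n (d ∸ 1)
𝒬 n d 1≤d 1≤n∸d (τ , i) = iterate (Π n (d ∸ 1)) (𝒮 n d 1≤d 1≤n∸d τ) (toℕ i)

{-# OPTIONS --safe #-}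
module Submission where

-- Write a path of area 1 as its sequence of blocks NE and D, one NE replaced by
-- the special block NNEE or NDE; call the NE's and the special block slots.  The
-- special block can occupy K = n − d slots (all of them for NNEE, all but the
-- last for NDE), and Π moves it cyclically through these, fixing everything else.
-- The path γ_τ has its special block in the first slot, and the rest of its
-- blocks is the indicator sequence of Des τ on n − 1, …, 1, with the last entry
-- set to NE; that entry says which special block occurs.  Since in hook shapes
-- every K-element set is the descent set of exactly one tableau, 𝒬 is bijective.
-- A descent i contributes i − 1, the number of blocks after its own, to
-- maj τ − des τ; the bounce statistic counts the same pairs of blocks, plus the
-- position of the special block.

open import Defs
open import Data.Bool.Base using (Bool; true; false)
open import Data.Fin.Base using (Fin; toℕ; fromℕ<)
open import Data.Fin.Properties using (toℕ-injective; toℕ-fromℕ<; toℕ<n)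
open import Data.List.Base
  using (List; []; _∷_; [_]; _++_; _∷ʳ_; concatMap; downFrom; filter; length; map; replicate)
open import Data.List.Extrema.Nat using (max; argmax-sel)
open import Data.List.Membership.Propositional using (_∈_; _∉_)
open import Data.List.Membership.Propositional.Properties
  using (∈-++⁺ˡ; ∈-++⁺ʳ; ∈-filter⁺; ∈-filter⁻)
open import Data.List.Properties
  using (++-assoc; ++-identityʳ; ∷-injectiveˡ; ∷-injectiveʳ; ∷ʳ-injective; ∷ʳ-injectiveˡ;
         length-++; length-map; length-downFrom; concat-map-[_]; filter-++; filter-all; filter-none)
open import Data.List.Relation.Binary.Permutation.Propositional using (_↭_; refl; prep; ↭-sym; ↭-trans; ↭-reflexive)
open import Data.List.Relation.Binary.Permutation.Propositional.Properties using (∈-resp-↭; shift; ∷↭∷ʳ)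
open import Data.List.Relation.Binary.Prefix.Heterogeneous using (Prefix; []; _∷_)
open import Data.List.Relation.Unary.All as All using (All; []; _∷_)
import Data.List.Relation.Unary.All.Properties as All
open import Data.List.Relation.Unary.AllPairs using (AllPairs; []; _∷_)
import Data.List.Relation.Unary.AllPairs.Properties as AllPairs
open import Data.List.Relation.Unary.Any using (here; there)
open import Data.List.Relation.Unary.Linked using (Linked; []; [-]; _∷_)
open import Data.List.Relation.Unary.Linked.Properties using (Linked⇒AllPairs; AllPairs⇒Linked)
open import Data.Nat.Base using (ℕ; zero; suc; pred; _+_; _*_; _∸_; _≤_; _<_; _>_; z≤n; s≤s; s≤s⁻¹)
open import Data.Nat.GeneralisedArithmetic using (iterate)
open import Data.Nat.ListAction using (sum)
open import Data.Nat.Properties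
open import Data.Nat.Tactic.RingSolver using (solve-∀)
open import Data.Product.Base using (∃; ∃₂; _×_; _,_; proj₁; proj₂)
open import Data.Product.Relation.Binary.Pointwise.NonDependent using (Pointwise)
open import Data.Sum.Base using (inj₁; inj₂)
open import Function.Base using (_on_; _∘_)
open import Function.Definitions using (Bijective; Injective; Surjective)
open import Level using (0ℓ)
open import Relation.Binary.PropositionalEquality hiding ([_])
open import Relation.Nullary using (¬_; Dec; yes; no; does; contradiction)
open import Relation.Nullary.Decidable using (dec-true; dec-false)
open import Relation.Unary using (Pred; Decidable)

open import Data.List.Membership.DecPropositional _≟_ using (_∈?_)

-- Boolean codes of block sequences: `true` for NE, `false` for D

trues : List Bool → ℕ
trues []          = 0
trues (true  ∷ b) = suc (trues b)
trues (false ∷ b) = trues b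

trues-++ : ∀ u v → trues (u ++ v) ≡ trues u + trues v
trues-++ []          v = refl
trues-++ (true  ∷ u) v = cong suc (trues-++ u v)
trues-++ (false ∷ u) v = trues-++ u v

trues-< : ∀ u v → trues u < trues (u ++ true ∷ v)
trues-< []          v = s≤s z≤n
trues-< (true  ∷ u) v = s≤s (trues-< u v)
trues-< (false ∷ u) v = trues-< u v

render : List Bool → Word
render []          = []
render (true  ∷ b) = NE ++ render b
render (false ∷ b) = D ∷ render b

special : Bool → Word
special true  = NNEE
special false = NDE

-- Slots are the `true` entries, numbered from 0 on the left; slot `p` receives the special block.
-- If there is no slot `p`, the result is just `render b`, hence the bounds `p < trues b` below.
mark : Bool → ℕ → List Bool → Word
mark t p       []          = []
mark t p       (false ∷ b) = D ∷ mark t p b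
mark t zero    (true ∷ b)  = special t ++ render b
mark t (suc p) (true ∷ b)  = NE ++ mark t p b

-- The last block of a path ending in NE cannot become NDE.
positions : Bool → List Bool → ℕ
positions true  b = trues b
positions false b = pred (trues b)

positions≤trues : ∀ t b → positions t b ≤ trues b
positions≤trues true  b = ≤-refl
positions≤trues false b = pred[n]≤n

render-++ : ∀ u v → render (u ++ v) ≡ render u ++ render v
render-++ []          v = refl
render-++ (true  ∷ u) v = cong (NE ++_) (render-++ u v)
render-++ (false ∷ u) v = cong (D ∷_) (render-++ u v)

render-D^ : ∀ j b → render (replicate j false ++ b) ≡ D^ j ++ render b
render-D^ zero    b = refl
render-D^ (suc j) b = cong (D ∷_) (render-D^ j b)

mark-D^ : ∀ t p j b → mark t p (replicate j false ++ b) ≡ D^ j ++ mark t p b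
mark-D^ t p zero    b = refl
mark-D^ t p (suc j) b = cong (D ∷_) (mark-D^ t p j b)

-- The slots of `u` come first, so passing over `u` lowers the slot number by `trues u`.
mark-++ : ∀ t p u b → mark t (p + trues u) (u ++ b) ≡ render u ++ mark t p b
mark-++ t p []          b = cong (λ q → mark t q b) (+-identityʳ p)
mark-++ t p (true  ∷ u) b rewrite +-suc p (trues u) = cong (NE ++_) (mark-++ t p u b)
mark-++ t p (false ∷ u) b = cong (D ∷_) (mark-++ t p u b)

[NE,D]*-render : ∀ {w} → [NE,D]* w → ∃ λ b → w ≡ render b
[NE,D]*-render []      = [] , refl
[NE,D]*-render (NE∷ p) with b , refl ← [NE,D]*-render p = true ∷ b , refl
[NE,D]*-render (D∷ p)  with b , refl ← [NE,D]*-render p = false ∷ b , refl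

render-injective : ∀ b b′ → render b ≡ render b′ → b ≡ b′
render-injective []          []           eq = refl
render-injective (true  ∷ b) (true  ∷ b′) eq = cong (true ∷_) (render-injective b b′ (∷-injectiveʳ (∷-injectiveʳ eq)))
render-injective (false ∷ b) (false ∷ b′) eq = cong (false ∷_) (render-injective b b′ (∷-injectiveʳ eq))
render-injective []          (true  ∷ _)  ()
render-injective []          (false ∷ _)  ()
render-injective (true  ∷ _) []           ()
render-injective (false ∷ _) []           ()
render-injective (true  ∷ _) (false ∷ _)  ()
render-injective (false ∷ _) (true  ∷ _)  ()

-- No two of the blocks D, NE, NNEE, NDE are such that one is a prefix of the other, so equal words
-- agree block by block. The bounds ensure that a special block occurs; without one, the word would
-- not determine `t` and `p`.
mark-injective : ∀ t p b t′ p′ b′ → p < trues b → p′ < trues b′ →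
                 mark t p b ≡ mark t′ p′ b′ → t ≡ t′ × p ≡ p′ × b ≡ b′
mark-injective t p (false ∷ b) t′ p′ (false ∷ b′) p< p′< eq
  with refl , refl , refl ← mark-injective t p b t′ p′ b′ p< p′< (∷-injectiveʳ eq) = refl , refl , refl
mark-injective t (suc p) (true ∷ b) t′ (suc p′) (true ∷ b′) p< p′< eq
  with refl , refl , refl ← mark-injective t p b t′ p′ b′ (s≤s⁻¹ p<) (s≤s⁻¹ p′<)
                              (∷-injectiveʳ (∷-injectiveʳ eq)) = refl , refl , refl
mark-injective true  zero (true ∷ b) true  zero (true ∷ b′) _ _ eq
  with refl ← render-injective b b′ (∷-injectiveʳ (∷-injectiveʳ (∷-injectiveʳ (∷-injectiveʳ eq)))) = refl , refl , refl
mark-injective false zero (true ∷ b) false zero (true ∷ b′) _ _ eq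
  with refl ← render-injective b b′ (∷-injectiveʳ (∷-injectiveʳ (∷-injectiveʳ eq))) = refl , refl , refl
mark-injective true    zero    (true ∷ b)  false   zero     (true ∷ b′)  _ _ ()
mark-injective false   zero    (true ∷ b)  true    zero     (true ∷ b′)  _ _ ()
mark-injective true    zero    (true ∷ b)  t′      (suc p′) (true ∷ b′)  _ _ ()
mark-injective false   zero    (true ∷ b)  t′      (suc p′) (true ∷ b′)  _ _ ()
mark-injective t       (suc p) (true ∷ b)  true    zero     (true ∷ b′)  _ _ ()
mark-injective t       (suc p) (true ∷ b)  false   zero     (true ∷ b′)  _ _ ()
mark-injective true    zero    (true ∷ b)  t′      p′       (false ∷ b′) _ _ ()
mark-injective false   zero    (true ∷ b)  t′      p′       (false ∷ b′) _ _ ()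
mark-injective t       (suc p) (true ∷ b)  t′      p′       (false ∷ b′) _ _ ()
mark-injective t       p       (false ∷ b) true    zero     (true ∷ b′)  _ _ ()
mark-injective t       p       (false ∷ b) false   zero     (true ∷ b′)  _ _ ()
mark-injective t       p       (false ∷ b) t′      (suc p′) (true ∷ b′)  _ _ ()

-- The action of Π on marked words

-- The target of wrap is left open: fewer than K iterations from slot 0 never wrap.
data Advance : Word → Word → Set where
  next : ∀ t p b → p < trues b → Advance (mark t p b) (mark t (suc p) b)
  wrap : ∀ t p b {w′} → p < trues b → positions t b ≡ suc p → Advance (mark t p b) w′

-- The common shape of rules 1 to 3: the special block stands in slot `trues u`, and the D's up to
-- the next NE are not slots.
next-special : ∀ t u j v → Advance (render u ++ special t ++ D^ j ++ NE ++ render v)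
                                   (render u ++ NE ++ D^ j ++ special t ++ render v)
next-special t u j v = subst₂ Advance before after (next t (trues u) b (trues-< u _))
  where
  b = u ++ true ∷ replicate j false ++ true ∷ v

  before : mark t (trues u) b ≡ render u ++ special t ++ D^ j ++ NE ++ render v
  before = trans (mark-++ t 0 u _) (cong (λ w → render u ++ special t ++ w) (render-D^ j (true ∷ v)))

  after : mark t (suc (trues u)) b ≡ render u ++ NE ++ D^ j ++ special t ++ render v
  after = trans (mark-++ t 1 u _) (cong (λ w → render u ++ NE ++ w) (mark-D^ t 0 j (true ∷ v)))

trues-D^ : ∀ j b → trues (replicate j false ++ b) ≡ trues b
trues-D^ zero    b = refl
trues-D^ (suc j) b = trues-D^ j b

-- In rules 4 and 5 the slots before the special block are the first NE and those of `u`, so its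
-- slot is `suc (trues u)`. This is the last admissible one: for NNEE no slot follows, for NDE only
-- the final NE.
↦-advance : ∀ {w w′} → w ↦ w′ → Advance w w′
↦-advance (rule₁ j p q)
  with u , refl ← [NE,D]*-render p | v , refl ← [NE,D]*-render (*-NE q) = next-special true u j v
↦-advance (rule₂ j p q)
  with u , refl ← [NE,D]*-render p | v , refl ← [NE,D]*-render (*-NE q) = next-special false u j v
↦-advance (rule₃ j p)
  with u , refl ← [NE,D]*-render p = next-special true u j []
↦-advance (rule₄ i j p) with u , refl ← [NE,D]*-render p =
  subst₂ Advance before refl (wrap true (suc (trues u)) b (≤-reflexive (sym size)) size)
  where
  b = replicate i false ++ true ∷ u ++ replicate j false ++ [ true ]

  before : mark true (suc (trues u)) b ≡ D^ i ++ NE ++ render u ++ D^ j ++ NNEE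
  before = trans (mark-D^ true (suc (trues u)) i _) (cong (λ w → D^ i ++ NE ++ w)
    (trans (mark-++ true 0 u _) (cong (render u ++_) (mark-D^ true 0 j [ true ]))))

  size : trues b ≡ 2 + trues u
  size = trans (trues-D^ i _) (cong suc (trans (trues-++ u _)
    (trans (cong (trues u +_) (trues-D^ j [ true ])) (+-comm (trues u) 1))))
↦-advance (rule₅ i j p) with u , refl ← [NE,D]*-render p =
  subst₂ Advance before refl
    (wrap false (suc (trues u)) b (≤-trans (n≤1+n _) (≤-reflexive (sym size))) (cong pred size))
  where
  b = replicate i false ++ true ∷ u ++ true ∷ replicate j false ++ [ true ]

  before : mark false (suc (trues u)) b ≡ D^ i ++ NE ++ render u ++ NDE ++ D^ j ++ NE
  before = trans (mark-D^ false (suc (trues u)) i _) (cong (λ w → D^ i ++ NE ++ w)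
    (trans (mark-++ false 0 u _) (cong (λ w → render u ++ NDE ++ w) (render-D^ j [ true ]))))

  size : trues b ≡ 3 + trues u
  size = trans (trues-D^ i _) (cong suc (trans (trues-++ u _)
    (trans (cong (λ k → trues u + suc k) (trues-D^ j [ true ])) (+-comm (trues u) 2))))

-- By `mark-injective` the slot recorded in the `Advance` is `p`, and the bound excludes `wrap`.
-- Hence it does not matter which applicable rule, or which decomposition of the word, Π has picked.
advance-mark : ∀ {w w′} t p b → Advance w w′ → w ≡ mark t p b → suc p < positions t b → w′ ≡ mark t (suc p) b
advance-mark t p b (next t′ p′ b′ p′<) eq p<
  with refl , refl , refl ← mark-injective t′ p′ b′ t p b p′< (≤-trans (<⇒≤ p<) (positions≤trues t b)) eq = refl
advance-mark t p b (wrap t′ p′ b′ p′< last) eq p<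
  with refl , refl , refl ← mark-injective t′ p′ b′ t p b p′< (≤-trans (<⇒≤ p<) (positions≤trues t b)) eq =
  contradiction (sym last) (<⇒≢ p<)

Π-mark : ∀ {n e} t p b (γ : Sch~₁ n e) → word γ ≡ mark t p b → positions t b ≡ n ∸ suc e →
         suc p < n ∸ suc e → word (Π n e γ) ≡ mark t (suc p) b
Π-mark {n} {e} t p b γ eq size p< with 2 ≤? n ∸ suc e
... | yes 2≤ = advance-mark t p b (↦-advance (proj₂ (Π-step n e 2≤ γ))) eq (subst (suc p <_) (sym size) p<)
... | no  2≰ = contradiction (≤-trans (s≤s (s≤s z≤n)) p<) 2≰

-- The starting slot is arbitrary because `iterate` applies Π to its seed first, which moves the
-- start to slot `suc p` in the induction.
iterate-Π-mark : ∀ {n e} t p b i (γ : Sch~₁ n e) → word γ ≡ mark t p b → positions t b ≡ n ∸ suc e →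
                 p + i < n ∸ suc e → word (iterate (Π n e) γ i) ≡ mark t (p + i) b
iterate-Π-mark t p b zero γ eq size p+i< = trans eq (cong (λ q → mark t q b) (sym (+-identityʳ p)))
iterate-Π-mark {n} {e} t p b (suc i) γ eq size p+i< =
  trans (iterate-Π-mark t (suc p) b i (Π n e γ)
          (Π-mark t p b γ eq size (≤-trans (s≤s (s≤s (m≤m+n p i))) p+i<′)) size p+i<′)
        (cong (λ q → mark t q b) (sym (+-suc p i)))
  where
  p+i<′ : suc (p + i) < n ∸ suc e
  p+i<′ = subst (_< n ∸ suc e) (+-suc p i) p+i<

-- Descent bits and the word of a tableau

module _ {P : Pred ℕ 0ℓ} (P? : Decidable P) where

  bits : ℕ → List Bool
  bits k = map (λ i → does (P? i)) (countdown k)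

  -- The bits of `suc k`, ..., 2. The bit of 1 is split off: the last block is a slot whatever its
  -- value, and that value selects NNEE or NDE instead.
  bits-init : ℕ → List Bool
  bits-init k = map (λ i → does (P? (2 + i))) (downFrom k)

  bits-∷ʳ : ∀ k → bits (suc k) ≡ bits-init k ∷ʳ does (P? 1)
  bits-∷ʳ zero    = refl
  bits-∷ʳ (suc k) = cong (does (P? (2 + k)) ∷_) (bits-∷ʳ k)

  length-bits : ∀ k → length (bits k) ≡ k
  length-bits k = trans (length-map _ (countdown k)) (trans (length-map suc (downFrom k)) (length-downFrom k))

  length-filter-bits : ∀ k → length (filter P? (countdown k)) ≡ trues (bits k)
  length-filter-bits zero    = refl
  length-filter-bits (suc k) with does (P? (suc k))
  ... | true  = cong suc (length-filter-bits k)
  ... | false = length-filter-bits k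

  module _ (m : ℕ) where

    private
      Ds : List ℕ
      Ds = filter P? (countdown m)

      M : ℕ
      M = max 0 Ds

      W : ℕ → Word
      W k = concatMap (γ-block Ds) (countdown k)

      base : ℕ → List Bool
      base k = bits-init k ∷ʳ true

      ∈⇒true : ∀ {i} → i ∈ Ds → does (P? i) ≡ true
      ∈⇒true i∈ = dec-true (P? _) (proj₂ (∈-filter⁻ P? {xs = countdown m} i∈))

      ∉⇒false : ∀ {i} → suc i ≤ m → suc i ∉ Ds → does (P? (suc i)) ≡ false
      ∉⇒false i≤m i∉ = dec-false (P? _) λ p → i∉ (∈-filter⁺ P? (∈-countdown⁺ (s≤s z≤n) i≤m) p)

    blocks-below-max : ∀ k → suc k ≤ m → suc k < M → W (suc k) ≡ render (base k)
    blocks-below-max zero k≤m k<M with γ-block Ds 1 | blockView Ds 1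
    ... | _ | first₁ 1≡M _ = contradiction 1≡M (<⇒≢ k<M)
    ... | _ | first₂ 1≡M _ = contradiction 1≡M (<⇒≢ k<M)
    ... | _ | another _ _  = refl
    ... | _ | none _ 1≢1 _ = contradiction refl 1≢1
    blocks-below-max (suc k) k≤m k<M with γ-block Ds (2 + k) | blockView Ds (2 + k)
    ... | _ | first₁ k≡M _        = contradiction k≡M (<⇒≢ k<M)
    ... | _ | first₂ k≡M _        = contradiction k≡M (<⇒≢ k<M)
    ... | _ | another _ (inj₂ k∈) rewrite ∈⇒true k∈ = cong (NE ++_) (blocks-below-max k (<⇒≤ k≤m) (<⇒≤ k<M))
    ... | _ | none _ _ k∉         rewrite ∉⇒false k≤m k∉ = cong (D ∷_) (blocks-below-max k (<⇒≤ k≤m) (<⇒≤ k<M))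

    module _ (M∈ : M ∈ Ds) where

      -- Reading downwards, the numbers above `M` give D's, so `M` is the first slot and carries the
      -- special block. Below it every block follows its bit.
      blocks-mark : ∀ k → suc k ≤ m → M ≤ suc k → W (suc k) ≡ mark (does (P? 1)) 0 (base k)
      -- Here `M` is 1, so 1 itself is in `Ds` and the block is NNEE; NDE cannot come last.
      blocks-mark zero k≤m M≤k with ≤-antisym M≤k (proj₁ (∈-countdown⁻ (proj₁ (∈-filter⁻ P? {xs = countdown m} M∈))))
      ... | M≡1 with γ-block Ds 1 | blockView Ds 1
      ... | _ | first₁ _ 1∈   rewrite ∈⇒true 1∈ = refl
      ... | _ | first₂ _ 1∉   = contradiction (subst (_∈ Ds) M≡1 M∈) 1∉
      ... | _ | another 1≢M _ = contradiction (sym M≡1) 1≢M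
      ... | _ | none 1≢M _ _  = contradiction (sym M≡1) 1≢M
      blocks-mark (suc k) k≤m M≤k with γ-block Ds (2 + k) | blockView Ds (2 + k)
      ... | _ | first₁ k≡M 1∈
        rewrite ∈⇒true (subst (_∈ Ds) (sym k≡M) M∈) | ∈⇒true 1∈ =
        cong (NNEE ++_) (blocks-below-max k (<⇒≤ k≤m) (≤-reflexive k≡M))
      ... | _ | first₂ k≡M 1∉
        rewrite ∈⇒true (subst (_∈ Ds) (sym k≡M) M∈) | ∉⇒false (≤-trans (s≤s z≤n) k≤m) 1∉ =
        cong (NDE ++_) (blocks-below-max k (<⇒≤ k≤m) (≤-reflexive k≡M))
      ... | _ | another k≢M (inj₂ k∈) = contradiction (≤-antisym (≤M P? m k∈) M≤k) k≢M
      ... | _ | none k≢M _ k∉ rewrite ∉⇒false k≤m k∉ =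
        cong (D ∷_) (blocks-mark k (<⇒≤ k≤m) (s≤s⁻¹ (≤∧≢⇒< M≤k (k≢M ∘ sym))))

  γ-blocks-mark : ∀ m → 1 ≤ trues (bits (suc m)) →
    concatMap (γ-block (filter P? (countdown (suc m)))) (countdown (suc m)) ≡
    mark (does (P? 1)) 0 (bits-init m ∷ʳ true)
  γ-blocks-mark m 1≤ = blocks-mark (suc m) M∈ m ≤-refl (M≤m P? (suc m) M∈)
    where
    Ds = filter P? (countdown (suc m))

    nonempty : ∀ {xs : List ℕ} → 1 ≤ length xs → ∃ λ x → x ∈ xs
    nonempty {x ∷ _} _ = x , here refl

    M∈ : max 0 Ds ∈ Ds
    M∈ with argmax-sel (λ x → x) 0 Ds
    ... | inj₂ M∈  = M∈
    -- The default value 0 of `max` is impossible, since `Ds` has an element and its elements are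
    -- positive.
    ... | inj₁ M≡0 with x , x∈ ← nonempty (≤-trans 1≤ (≤-reflexive (sym (length-filter-bits (suc m))))) =
      contradiction (subst (x ≤_) M≡0 (≤M P? (suc m) x∈))
        (<⇒≱ (proj₁ (∈-countdown⁻ (proj₁ (∈-filter⁻ P? {xs = countdown (suc m)} x∈)))))

-- Weights and step counts of codes

-- In a list of bits counted down to 1, the bit of i has i - 1 entries after it, so this is the sum
-- of i - 1 over the true bits.
weight : List Bool → ℕ
weight []          = 0
weight (true  ∷ b) = length b + weight b
weight (false ∷ b) = weight b

sum-filter : ∀ {P : Pred ℕ 0ℓ} (P? : Decidable P) k →
             sum (filter P? (countdown k)) ≡ weight (bits P? k) + length (filter P? (countdown k))
sum-filter P? zero    = refl
sum-filter P? (suc k) with does (P? (suc k))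
... | false = sum-filter P? k
... | true  rewrite sum-filter P? k | length-bits P? k =
  trans (cong suc (sym (+-assoc k _ _))) (sym (+-suc (k + weight (bits P? k)) _))

-- Nothing follows the last entry, so replacing the bit of 1 by the final slot does not change the
-- weight.
weight-∷ʳ : ∀ c t → weight (c ∷ʳ t) ≡ weight (c ∷ʳ true)
weight-∷ʳ []          true  = refl
weight-∷ʳ []          false = refl
weight-∷ʳ (false ∷ c) t     = weight-∷ʳ c t
weight-∷ʳ (true  ∷ c) t     =
  cong₂ _+_ (trans (length-++ c) (sym (length-++ c))) (weight-∷ʳ c t)

-- This matches descents with admissible slots: if 1 is not a descent, the final slot has no
-- descent, and it is the one that NDE may not occupy.
trues-∷ʳ : ∀ c t → trues (c ∷ʳ t) ≡ positions t (c ∷ʳ true)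
trues-∷ʳ c true  = refl
trues-∷ʳ c false = begin
  trues (c ∷ʳ false)      ≡⟨ trues-++ c [ false ] ⟩
  trues c + 0             ≡⟨ cong pred (+-suc (trues c) 0) ⟨
  pred (trues c + 1)      ≡⟨ cong pred (trues-++ c [ true ]) ⟨
  pred (trues (c ∷ʳ true)) ∎
  where open ≡-Reasoning

norths+diagonals : Word → ℕ
norths+diagonals w = count N w + count D w

size-render : ∀ b → norths+diagonals (render b) ≡ length b
size-render []          = refl
size-render (true  ∷ b) = cong suc (size-render b)
size-render (false ∷ b) = trans (+-suc _ _) (cong suc (size-render b))

size-mark : ∀ t p b → p < trues b → norths+diagonals (mark t p b) ≡ suc (length b)
size-mark t     p       (false ∷ b) p<       = trans (+-suc _ _) (cong suc (size-mark t p b p<))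
size-mark true  zero    (true ∷ b)  p<       = cong (2 +_) (size-render b)
size-mark false zero    (true ∷ b)  p<       = trans (cong suc (+-suc _ _)) (cong (2 +_) (size-render b))
size-mark t     (suc p) (true ∷ b)  (s≤s p<) = cong suc (size-mark t p b p<)

norths-render : ∀ b → count N (render b) ≡ trues b
norths-render []          = refl
norths-render (true  ∷ b) = cong suc (norths-render b)
norths-render (false ∷ b) = norths-render b

norths-mark : ∀ t p b → p < trues b → count N (mark t p b) ≡ suc (positions t b)
-- `positions` reduces only once `t` is known.
norths-mark t     p       (false ∷ b) p< with t | norths-mark t p b p<
... | true  | eq = eq
... | false | eq = eq
norths-mark true  zero    (true ∷ b)  p<       = cong (2 +_) (norths-render b)
norths-mark false zero    (true ∷ b)  p<       = cong suc (norths-render b)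
norths-mark true  (suc p) (true ∷ b)  (s≤s p<) = cong suc (norths-mark true p b p<)
norths-mark false (suc p) (true ∷ b)  (s≤s p<) =
  cong suc (trans (norths-mark false p b p<) (suc-pred′ (≤-trans (s≤s z≤n) p<)))
  where
  suc-pred′ : ∀ {k} → 1 ≤ k → suc (pred k) ≡ k
  suc-pred′ (s≤s _) = refl

-- The bounce of a marked word

count-Γ : ∀ w → count N (Γ w) ≡ count N w
count-Γ []      = refl
count-Γ (N ∷ w) = cong suc (count-Γ w)
count-Γ (E ∷ w) = count-Γ w
count-Γ (D ∷ w) = count-Γ w

Before : ℕ → List (ℕ × ℕ) → Set
Before e = All (λ (x , y) → x < e)

Before-∷ʳ : ∀ {e e′ y qs} → Before e qs → e < e′ → Before e′ (qs ∷ʳ (e , y))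
Before-∷ʳ qs<e e<e′ = All.++⁺ (All.map (λ x<e → <-trans x<e e<e′) qs<e) (e<e′ ∷ [])

turns≥ : ∀ x y b w → All (λ (x′ , _) → x ≤ x′) (turnsFrom x y b w)
turns≥ x y b []      = []
turns≥ x y b (N ∷ w) = turns≥ x (suc y) b w
turns≥ x y b (D ∷ w) = All.map <⇒≤ (turns≥ (suc x) (suc y) b w)
turns≥ x y b (E ∷ w) with does (x ≟ b)
... | true  = ≤-refl ∷ All.map <⇒≤ (turns≥ (suc x) y y w)
... | false = All.map <⇒≤ (turns≥ (suc x) y b w)

-- The contribution to the bounce of the part w of a path from the point (e , e)
-- on: T is the size of its Dyck path and qs lists the turning points before w.
score : ℕ → List (ℕ × ℕ) → ℕ → Word → ℕ
score T qs e w = sum (map (λ (x , y) → T ∸ y) (turnsFrom e e e (Γ w)))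
               + numphFrom (qs ++ turnsFrom e e e (Γ w)) e w

bounce-score : ∀ w → bounce w ≡ score (count N w) [] 0 w
bounce-score w = cong (λ T → score T [] 0 w) (count-Γ w)

-- Turning points still to come lie on lines x ≥ `e`, so only those in `qs` are counted.
peaks-before : ∀ qs e w → Before e qs →
  length (filter (λ (x , y) → x <? e) (qs ++ turnsFrom e e e w)) ≡ length qs
peaks-before qs e w qs<e = begin
  length (filter P? (qs ++ ps))           ≡⟨ cong length (filter-++ P? qs ps) ⟩
  length (filter P? qs ++ filter P? ps)   ≡⟨ cong₂ (λ xs ys → length (xs ++ ys)) (filter-all P? qs<e)
                                               (filter-none P? (All.map ≤⇒≯ (turns≥ e e e w))) ⟩
  length (qs ++ [])                       ≡⟨ cong length (++-identityʳ qs) ⟩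
  length qs                               ∎
  where
  open ≡-Reasoning
  ps = turnsFrom e e e w
  P? : Decidable (λ ((x , y) : ℕ × ℕ) → x < e)
  P? (x , y) = x <? e

private
  exchange : ∀ a b c → a + (b + c) ≡ b + (a + c)
  exchange = solve-∀

score-D : ∀ T qs e w → Before e qs → score T qs e (D ∷ w) ≡ length qs + score T qs e w
score-D T qs e w qs<e rewrite peaks-before qs e (Γ w) qs<e =
  exchange (sum (map (λ (x , y) → T ∸ y) ps)) (length qs) (numphFrom (qs ++ ps) e w)
  where ps = turnsFrom e e e (Γ w)

turns-NE : ∀ e w → turnsFrom e e e (NE ++ w) ≡ (e , suc e) ∷ turnsFrom (suc e) (suc e) (suc e) w
turns-NE e w = if-yes (e ≟ e) refl

-- The bounce path runs from the first E straight back to the diagonal at `2 + e`, so the second E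
-- is not a peak step.
turns-NNEE : ∀ e w → turnsFrom e e e (NNEE ++ w) ≡ (e , 2 + e) ∷ turnsFrom (2 + e) (2 + e) (2 + e) w
turns-NNEE e w = trans (if-yes (e ≟ e) refl)
  (cong ((e , 2 + e) ∷_) (if-no (suc e ≟ 2 + e) (<⇒≢ ≤-refl)))

score-NE : ∀ T qs e w → score T qs e (NE ++ w) ≡ (T ∸ suc e) + score T (qs ∷ʳ (e , suc e)) (suc e) w
score-NE T qs e w
  rewrite turns-NE e (Γ w)
        | ++-assoc qs [ (e , suc e) ] (turnsFrom (suc e) (suc e) (suc e) (Γ w)) = +-assoc (T ∸ suc e) _ _

score-NNEE : ∀ T qs e w → score T qs e (NNEE ++ w) ≡ (T ∸ (2 + e)) + score T (qs ∷ʳ (e , 2 + e)) (2 + e) w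
score-NNEE T qs e w
  rewrite turns-NNEE e (Γ w)
        | ++-assoc qs [ (e , 2 + e) ] (turnsFrom (2 + e) (2 + e) (2 + e) (Γ w)) = +-assoc (T ∸ (2 + e)) _ _

-- Γ turns NDE into NE, and the D precedes the peak step of its own block, so it counts only the
-- peaks in `qs`.
score-NDE : ∀ T qs e w → Before e qs →
  score T qs e (NDE ++ w) ≡ length qs + ((T ∸ suc e) + score T (qs ∷ʳ (e , suc e)) (suc e) w)
score-NDE T qs e w qs<e = trans
  (trans (cong (λ k → s + (k + numphFrom ps e (NE ++ w))) (peaks-before qs e (NE ++ Γ w) qs<e))
         (exchange s (length qs) _))
  (cong (length qs +_) (score-NE T qs e w))
  where
  ps = qs ++ turnsFrom e e e (NE ++ Γ w)
  s  = sum (map (λ (x , y) → T ∸ y) (turnsFrom e e e (NE ++ Γ w)))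

length-∷ʳ : ∀ {A : Set} (xs : List A) x → length (xs ∷ʳ x) ≡ suc (length xs)
length-∷ʳ xs x = trans (length-++ xs) (+-comm (length xs) 1)

-- The true entries of b contribute the number of blocks after them: every
-- later NE block through the Dyck path, every later D through numph.
score-render : ∀ T qs e b → T ≡ e + count N (render b) → Before e qs →
               score T qs e (render b) ≡ weight b + length qs * count D (render b)
score-render T qs e []          T≡ qs<e = sym (*-zeroʳ (length qs))
score-render T qs e (false ∷ b) T≡ qs<e = begin
  score T qs e (D ∷ render b)        ≡⟨ score-D T qs e (render b) qs<e ⟩
  q + score T qs e (render b)        ≡⟨ cong (q +_) (score-render T qs e b T≡ qs<e) ⟩
  q + (weight b + q * d)             ≡⟨ exchange q (weight b) (q * d) ⟩
  weight b + (q + q * d)             ≡⟨ cong (weight b +_) (*-suc q d) ⟨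
  weight b + q * suc d               ∎
  where
  open ≡-Reasoning
  q = length qs
  d = count D (render b)
score-render T qs e (true ∷ b) T≡ qs<e = begin
  score T qs e (NE ++ render b)                   ≡⟨ score-NE T qs e (render b) ⟩
  (T ∸ suc e) + score T qs′ (suc e) (render b)    ≡⟨ cong₂ _+_ (trans (cong (_∸ suc e) T≡′) (m+n∸m≡n (suc e) c))
                                                      (score-render T qs′ (suc e) b T≡′ (Before-∷ʳ qs<e ≤-refl)) ⟩
  c + (weight b + length qs′ * d)                 ≡⟨ cong (λ k → c + (weight b + k * d)) (length-∷ʳ qs _) ⟩
  c + (weight b + suc q * d)                      ≡⟨ regroup c (weight b) q d ⟩
  c + d + weight b + q * d                        ≡⟨ cong (λ k → k + weight b + q * d) (size-render b) ⟩
  length b + weight b + q * d                     ∎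
  where
  open ≡-Reasoning
  q   = length qs
  c   = count N (render b)
  d   = count D (render b)
  qs′ = qs ∷ʳ (e , suc e)
  T≡′ : T ≡ suc e + c
  T≡′ = trans T≡ (+-suc e c)
  regroup : ∀ c w q d → c + (w + suc q * d) ≡ c + d + w + q * d
  regroup = solve-∀

-- An NE before the special block has one more N or D step after it than blocks (`size-mark`); this
-- excess gives the summand `p`. The special block contributes the number of blocks after it, as an
-- NE would. The last summand counts the earlier peaks for each D, including the D inside NDE.
score-mark : ∀ T qs e t p b → p < trues b → T ≡ e + count N (mark t p b) → Before e qs →
             score T qs e (mark t p b) ≡ weight b + p + length qs * count D (mark t p b)
score-mark T qs e t p (false ∷ b) p< T≡ qs<e = begin
  score T qs e (D ∷ mark t p b)      ≡⟨ score-D T qs e (mark t p b) qs<e ⟩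
  q + score T qs e (mark t p b)      ≡⟨ cong (q +_) (score-mark T qs e t p b p< T≡ qs<e) ⟩
  q + (weight b + p + q * d)         ≡⟨ exchange q (weight b + p) (q * d) ⟩
  weight b + p + (q + q * d)         ≡⟨ cong (weight b + p +_) (*-suc q d) ⟨
  weight b + p + q * suc d           ∎
  where
  open ≡-Reasoning
  q = length qs
  d = count D (mark t p b)
score-mark T qs e t (suc p) (true ∷ b) (s≤s p<) T≡ qs<e = begin
  score T qs e (NE ++ mark t p b)                   ≡⟨ score-NE T qs e (mark t p b) ⟩
  (T ∸ suc e) + score T qs′ (suc e) (mark t p b)    ≡⟨ cong₂ _+_ (trans (cong (_∸ suc e) T≡′) (m+n∸m≡n (suc e) c))
                                                        (score-mark T qs′ (suc e) t p b p< T≡′ (Before-∷ʳ qs<e ≤-refl)) ⟩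
  c + (weight b + p + length qs′ * d)               ≡⟨ cong (λ k → c + (weight b + p + k * d)) (length-∷ʳ qs _) ⟩
  c + (weight b + p + suc q * d)                    ≡⟨ regroup c (weight b) p q d ⟩
  c + d + (weight b + p) + q * d                    ≡⟨ cong (λ k → k + (weight b + p) + q * d) (size-mark t p b p<) ⟩
  suc (length b) + (weight b + p) + q * d           ≡⟨ shuffle (length b) (weight b) p (q * d) ⟩
  length b + weight b + suc p + q * d               ∎
  where
  open ≡-Reasoning
  q   = length qs
  c   = count N (mark t p b)
  d   = count D (mark t p b)
  qs′ = qs ∷ʳ (e , suc e)
  T≡′ : T ≡ suc e + c
  T≡′ = trans T≡ (+-suc e c)
  regroup : ∀ c w p q d → c + (w + p + suc q * d) ≡ c + d + (w + p) + q * d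
  regroup = solve-∀
  shuffle : ∀ l w p r → suc l + (w + p) + r ≡ l + w + suc p + r
  shuffle = solve-∀
score-mark T qs e true zero (true ∷ b) p< T≡ qs<e = begin
  score T qs e (NNEE ++ render b)                       ≡⟨ score-NNEE T qs e (render b) ⟩
  (T ∸ (2 + e)) + score T qs′ (2 + e) (render b)        ≡⟨ cong₂ _+_ (trans (cong (_∸ (2 + e)) T≡′) (m+n∸m≡n (2 + e) c))
                                                            (score-render T qs′ (2 + e) b T≡′ (Before-∷ʳ qs<e (n≤1+n _))) ⟩
  c + (weight b + length qs′ * d)                       ≡⟨ cong (λ k → c + (weight b + k * d)) (length-∷ʳ qs _) ⟩
  c + (weight b + suc q * d)                            ≡⟨ regroup c (weight b) q d ⟩
  c + d + weight b + 0 + q * d                          ≡⟨ cong (λ k → k + weight b + 0 + q * d) (size-render b) ⟩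
  length b + weight b + 0 + q * d                       ∎
  where
  open ≡-Reasoning
  q   = length qs
  c   = count N (render b)
  d   = count D (render b)
  qs′ = qs ∷ʳ (e , 2 + e)
  T≡′ : T ≡ 2 + e + c
  T≡′ = trans T≡ (trans (+-suc e (suc c)) (cong suc (+-suc e c)))
  regroup : ∀ c w q d → c + (w + suc q * d) ≡ c + d + w + 0 + q * d
  regroup = solve-∀
score-mark T qs e false zero (true ∷ b) p< T≡ qs<e = begin
  score T qs e (NDE ++ render b)                        ≡⟨ score-NDE T qs e (render b) qs<e ⟩
  q + ((T ∸ suc e) + score T qs′ (suc e) (render b))    ≡⟨ cong (q +_) (cong₂ _+_ (trans (cong (_∸ suc e) T≡′) (m+n∸m≡n (suc e) c))
                                                            (score-render T qs′ (suc e) b T≡′ (Before-∷ʳ qs<e ≤-refl))) ⟩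
  q + (c + (weight b + length qs′ * d))                 ≡⟨ cong (λ k → q + (c + (weight b + k * d))) (length-∷ʳ qs _) ⟩
  q + (c + (weight b + suc q * d))                      ≡⟨ regroup c (weight b) q d ⟩
  c + d + weight b + 0 + q * suc d                      ≡⟨ cong (λ k → k + weight b + 0 + q * suc d) (size-render b) ⟩
  length b + weight b + 0 + q * suc d                   ∎
  where
  open ≡-Reasoning
  q   = length qs
  c   = count N (render b)
  d   = count D (render b)
  qs′ = qs ∷ʳ (e , suc e)
  T≡′ : T ≡ suc e + c
  T≡′ = trans T≡ (+-suc e c)
  regroup : ∀ c w q d → q + (c + (w + suc q * d)) ≡ c + d + w + 0 + q * suc d
  regroup = solve-∀

bounce-mark : ∀ t p b → p < trues b → bounce (mark t p b) ≡ weight b + p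
bounce-mark t p b p< = begin
  bounce (mark t p b)                                ≡⟨ bounce-score (mark t p b) ⟩
  score (count N (mark t p b)) [] 0 (mark t p b)     ≡⟨ score-mark _ [] 0 t p b p< refl [] ⟩
  weight b + p + 0                                   ≡⟨ +-identityʳ (weight b + p) ⟩
  weight b + p                                       ∎
  where open ≡-Reasoning

-- A hook tableau is determined by its descents

sorted-≡ : ∀ {xs ys} → AllPairs _<_ xs → AllPairs _<_ ys →
           (∀ {z} → z ∈ xs → z ∈ ys) → (∀ {z} → z ∈ ys → z ∈ xs) → xs ≡ ys
sorted-≡ []           []           _   _   = refl
sorted-≡ []           (_ ∷ _)      _   ys⊆ with () ← ys⊆ (here refl)
sorted-≡ (_ ∷ _)      []           xs⊆ _   with () ← xs⊆ (here refl)
sorted-≡ {x ∷ xs} {y ∷ ys} (x< ∷ xs<) (y< ∷ ys<) xs⊆ ys⊆ with heads (xs⊆ (here refl)) (ys⊆ (here refl))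
  where
  heads : x ∈ y ∷ ys → y ∈ x ∷ xs → x ≡ y
  heads (here x≡y)  _           = x≡y
  heads (there _)   (here y≡x)  = sym y≡x
  heads (there x∈)  (there y∈)  = contradiction (All.lookup x< y∈) (<⇒≯ (All.lookup y< x∈))
... | refl = cong (x ∷_) (sorted-≡ xs< ys< (tail x< xs⊆) (tail y< ys⊆))
  where
  tail : ∀ {zs ws} → All (x <_) zs → (∀ {z} → z ∈ x ∷ zs → z ∈ x ∷ ws) → ∀ {z} → z ∈ zs → z ∈ ws
  tail x<zs zs⊆ z∈ with zs⊆ (there z∈)
  ... | here refl = contradiction (All.lookup x<zs z∈) (<-irrefl refl)
  ... | there z∈′ = z∈′

-- Here `r` is the bottom row, and `c` is the column above the corner, read upwards.
record IsHook (s : ℕ) (r c : List ℕ) : Set where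
  constructor isHook
  field
    {corner}  : ℕ
    {arm}     : List ℕ
    r≡        : r ≡ corner ∷ arm
    standard  : (corner ∷ arm) ++ c ↭ countdown s
    row-<     : AllPairs _<_ (corner ∷ arm)
    col-<     : Linked _<_ (corner ∷ c)

SYT-isHook : ∀ {d K} → 1 ≤ d → (τ : SYT (d ∷ replicate K 1)) →
             ∃₂ λ r c → rows τ ≡ r ∷ map [_] c × IsHook (d + sum (replicate K 1)) r c
SYT-isHook {d} {K} 1≤d τ with rows τ | SYT.lengths τ | SYT.standard τ | SYT.rows-< τ | SYT.cols-< τ
... | (a ∷ as) ∷ cs | eq | st | row ∷ _ | cols with c , refl , _ ← singletons cs K (∷-injectiveʳ eq) =
  a ∷ as , c , refl , isHook refl
    (subst (λ xs → (a ∷ as) ++ xs ↭ countdown (d + sum (replicate K 1))) (concat-map-[_] c) st)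
    (Linked⇒AllPairs <-trans row) (column-< a as c cols)
... | [] ∷ cs | eq | _ | _ | _ = contradiction (subst (1 ≤_) (sym (∷-injectiveˡ eq)) 1≤d) λ ()

map-≡⇒≡ : ∀ {A B : Set} {f g : A → B} {xs x} → map f xs ≡ map g xs → x ∈ xs → f x ≡ g x
map-≡⇒≡ eq (here refl) = ∷-injectiveˡ eq
map-≡⇒≡ eq (there x∈)  = map-≡⇒≡ (∷-injectiveʳ eq) x∈

does-⇒ : ∀ {P Q : Set} (P? : Dec P) (Q? : Dec Q) → does P? ≡ does Q? → P → Q
does-⇒ P?      (yes q) _  _ = q
does-⇒ (yes p) (no ¬q) () _
does-⇒ (no ¬p) (no ¬q) _  p = contradiction p ¬p

descentBits : ℕ → List (List ℕ) → List Bool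
descentBits m rs = bits (descent? rs) m

-- An entry j ≥ 2 lies outside the bottom row exactly when j - 1 is a descent, and 1 always lies in
-- that row.
row-⊆ : ∀ {m r c r′ c′} → IsHook (suc m) r c → IsHook (suc m) r′ c′ →
        descentBits m (r ∷ map [_] c) ≡ descentBits m (r′ ∷ map [_] c′) →
        ∀ {j} → j ∈ r → j ∈ r′
row-⊆ {m} {r} {c} {r′} {c′} (isHook refl st _ _) (isHook {a′} {as′} refl st′ _ col′) eq j∈ =
  transfer j∈ (∈-countdown⁻ (∈-resp-↭ st (∈-++⁺ˡ j∈)))
  where
  transfer : ∀ {j} → j ∈ r → 1 ≤ j × j ≤ suc m → j ∈ r′
  transfer {suc zero}    j∈ _          = 1∈r (suc m) a′ as′ c′ st′ col′ (s≤s z≤n)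
  transfer {suc (suc i)} j∈ (_ , j≤) with (2 + i) ∈? r′
  ... | yes j∈′ = j∈′
  ... | no  j∉′ = contradiction
    (does-⇒ (descent? (r′ ∷ map [_] c′) (suc i)) (descent? (r ∷ map [_] c) (suc i))
      (sym (map-≡⇒≡ eq (∈-countdown⁺ (s≤s z≤n) (s≤s⁻¹ j≤))))
      (∉r⇒descent (suc m) a′ as′ c′ st′ col′ (s≤s z≤n) j≤ j∉′))
    (no-descent r (map [_] c) j∈)

column-⊆ : ∀ {s r c r′ c′} → IsHook s r c → IsHook s r′ c′ → (∀ {j} → j ∈ r′ → j ∈ r) →
           ∀ {j} → j ∈ c → j ∈ c′
column-⊆ {s} {c = c} {c′ = c′} (isHook {a} {as} refl st _ col) (isHook {a′} {as′} refl st′ _ col′) r′⊆r {j} j∈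
  with 1≤j , j≤s ← ∈-countdown⁻ (∈-resp-↭ st (∈-++⁺ʳ (a ∷ as) j∈))
  with entry s a′ as′ c′ st′ col′ 1≤j j≤s
... | inj₂ j∈′ = j∈′
... | inj₁ j∈r′ = contradiction j∈ (disjoint (unique s a as c st col) (r′⊆r j∈r′))

IsHook-unique : ∀ {m r c r′ c′} → IsHook (suc m) r c → IsHook (suc m) r′ c′ →
                descentBits m (r ∷ map [_] c) ≡ descentBits m (r′ ∷ map [_] c′) →
                _≡_ {A = List (List ℕ)} (r ∷ map [_] c) (r′ ∷ map [_] c′)
IsHook-unique h@(isHook refl _ row col) h′@(isHook refl _ row′ col′) eq =
  cong₂ (λ (r c : List ℕ) → r ∷ map [_] c)
    (sorted-≡ row row′ r⊆r′ r′⊆r)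
    (sorted-≡ (tail col) (tail col′) (column-⊆ h h′ r′⊆r) (column-⊆ h′ h r⊆r′))
  where
  r⊆r′ = λ {j} → row-⊆ h h′ eq {j}
  r′⊆r = λ {j} → row-⊆ h′ h (sym eq) {j}
  tail : ∀ {x xs} → Linked _<_ (x ∷ xs) → AllPairs _<_ xs
  tail l with _ ∷ ps ← Linked⇒AllPairs <-trans l = ps

-- The hook tableau with prescribed descents

-- Position i of the bit list, counted down to 1, says whether i + 1 lies in the
-- column.
entries : Bool → List Bool → List ℕ
entries t     []          = []
entries true  (true  ∷ b) = entries true b ∷ʳ (2 + length b)
entries false (true  ∷ b) = entries false b
entries true  (false ∷ b) = entries true b
entries false (false ∷ b) = entries false b ∷ʳ (2 + length b)

entries-< : ∀ t b → All (_< 2 + length b) (entries t b)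
entries-< t     []          = []
entries-< true  (true  ∷ b) = All.++⁺ (All.map m<n⇒m<1+n (entries-< true b)) (≤-refl ∷ [])
entries-< false (true  ∷ b) = All.map m<n⇒m<1+n (entries-< false b)
entries-< true  (false ∷ b) = All.map m<n⇒m<1+n (entries-< true b)
entries-< false (false ∷ b) = All.++⁺ (All.map m<n⇒m<1+n (entries-< false b)) (≤-refl ∷ [])

entries-sorted : ∀ t b → AllPairs _<_ (1 ∷ entries t b)
entries-sorted t     []          = [] ∷ []
entries-sorted true  (false ∷ b) = entries-sorted true b
entries-sorted false (true  ∷ b) = entries-sorted false b
entries-sorted true  (true  ∷ b) = AllPairs.++⁺ (entries-sorted true b) ([] ∷ [])
  ((s≤s (s≤s z≤n) ∷ []) ∷ All.map (_∷ []) (entries-< true b))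
entries-sorted false (false ∷ b) = AllPairs.++⁺ (entries-sorted false b) ([] ∷ [])
  ((s≤s (s≤s z≤n) ∷ []) ∷ All.map (_∷ []) (entries-< false b))

entries-standard : ∀ b → 1 ∷ entries false b ++ entries true b ↭ countdown (suc (length b))
entries-standard []          = refl
entries-standard (true  ∷ b) = ↭-trans
  (↭-trans (↭-reflexive (sym (++-assoc (1 ∷ entries false b) (entries true b) _)))
           (↭-sym (∷↭∷ʳ (2 + length b) _)))
  (prep _ (entries-standard b))
entries-standard (false ∷ b) = ↭-trans
  (↭-trans (↭-reflexive (++-assoc (1 ∷ entries false b) [ 2 + length b ] (entries true b)))
           (shift (2 + length b) (1 ∷ entries false b) (entries true b)))
  (prep _ (entries-standard b))

length-column : ∀ b → length (entries true b) ≡ trues b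
length-column []          = refl
length-column (true  ∷ b) = trans (length-∷ʳ (entries true b) _) (cong suc (length-column b))
length-column (false ∷ b) = length-column b

length-row : ∀ b → length (entries false b) + trues b ≡ length b
length-row []          = refl
length-row (true  ∷ b) = trans (+-suc _ _) (cong suc (length-row b))
length-row (false ∷ b) = trans (cong (_+ trues b) (length-∷ʳ (entries false b) _)) (cong suc (length-row b))

-- The predicate is abstract so that the induction can shorten `b` while the tableau defining the
-- descents stays fixed.
bits-entries : ∀ {P : Pred ℕ 0ℓ} (P? : Decidable P) b →
               (∀ {i} → suc i ∈ entries true b → P i) → (∀ {i} → suc i ∈ entries false b → ¬ P i) →
               bits P? (length b) ≡ b
bits-entries P? []          yes′ no′ = refl
bits-entries P? (true  ∷ b) yes′ no′ = cong₂ _∷_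
  (dec-true (P? _) (yes′ (∈-++⁺ʳ (entries true b) (here refl))))
  (bits-entries P? b (λ i∈ → yes′ (∈-++⁺ˡ i∈)) no′)
bits-entries P? (false ∷ b) yes′ no′ = cong₂ _∷_
  (dec-false (P? _) (no′ (∈-++⁺ʳ (entries false b) (here refl))))
  (bits-entries P? b yes′ (λ i∈ → no′ (∈-++⁺ˡ i∈)))

hookRows : List Bool → List (List ℕ)
hookRows b = (1 ∷ entries false b) ∷ map [_] (entries true b)

bits-hookRows : ∀ b → descentBits (length b) (hookRows b) ≡ b
bits-hookRows b = bits-entries (descent? (hookRows b)) b yes′ no′
  where
  r = entries false b
  c = entries true b
  s = suc (length b)
  st = entries-standard b
  col = AllPairs⇒Linked (entries-sorted true b)

  yes′ : ∀ {i} → suc i ∈ c → Descent (hookRows b) i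
  yes′ {zero}  1∈ with 1< ∷ _ ← entries-sorted true b = contradiction (All.lookup 1< 1∈) (<-irrefl refl)
  yes′ {suc i} j∈ = ∉r⇒descent s 1 r c st col (s≤s z≤n)
    (s≤s⁻¹ (All.lookup (entries-< true b) j∈))
    (λ j∈r → disjoint (unique s 1 r c st col) j∈r j∈)

  no′ : ∀ {i} → suc i ∈ r → ¬ Descent (hookRows b) i
  no′ j∈ = no-descent (1 ∷ r) (map [_] c) (there j∈)

hookSYT : ∀ {d K} b → d + K ≡ suc (length b) → trues b ≡ K → SYT (d ∷ replicate K 1)
hookSYT {d} {K} b size trues≡ = record
  { rows     = hookRows b
  ; lengths  = cong₂ _∷_ d≡ (trans (lengths-[_] (entries true b)) (cong (λ k → replicate k 1) (trans (length-column b) trues≡)))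
  ; standard = subst₂ (λ xs k → (1 ∷ entries false b) ++ xs ↭ countdown k)
                 (sym (concat-map-[_] (entries true b)))
                 (trans (sym size) (cong (d +_) (sym (sum-ones K))))
                 (entries-standard b)
  ; rows-<   = AllPairs⇒Linked (entries-sorted false b) ∷ singletons-< (entries true b)
  ; cols-<   = column-Linked 1 (entries false b) (entries true b) (AllPairs⇒Linked (entries-sorted true b))
  }
  where
  d≡ : suc (length (entries false b)) ≡ d
  d≡ = +-cancelʳ-≡ K _ _ (trans (cong (suc (length (entries false b)) +_) (sym trues≡))
    (trans (cong suc (length-row b)) (sym size)))

  lengths-[_] : (xs : List ℕ) → map length (map [_] xs) ≡ replicate (length xs) 1
  lengths-[ [] ]     = refl
  lengths-[ x ∷ xs ] = cong (1 ∷_) lengths-[ xs ]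

  sum-ones : ∀ k → sum (replicate k 1) ≡ k
  sum-ones zero    = refl
  sum-ones (suc k) = cong suc (sum-ones k)

  singletons-< : ∀ xs → All (Linked _<_) (map [_] xs)
  singletons-< []       = []
  singletons-< (x ∷ xs) = [-] ∷ singletons-< xs

  column-Linked : ∀ a as c → Linked _<_ (a ∷ c) →
                  Linked (λ lower upper → Prefix _>_ upper lower) ((a ∷ as) ∷ map [_] c)
  column-Linked a as []      _         = [-]
  column-Linked a as (x ∷ c) (a<x ∷ l) = (a<x ∷ []) ∷ column-Linked x [] c l


-- Every path of area 1 is a marked word

path : ∀ {n e} (γ : Sch~₁ n e) → Path 0 1 (word γ)
path {e = e} γ = subst (λ a → Path 0 a (word γ)) area≡1
  (toPath 0 0 (word γ) (+-cancelʳ-≡ e _ _ (trans norths (sym easts))) prefixes)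
  where
  open Sch~₁ γ using (isSchröder; area≡1)
  open IsSchröder isSchröder

-- A path whose last N is followed only by E's ends with a slot, hence the final `true`; the bound
-- by `positions` keeps NDE out of that slot.
data Marked : Word → Set where
  marked : ∀ t p c → p < positions t (c ∷ʳ true) → Marked (mark t p (c ∷ʳ true))

marked-at : ∀ t u v → Marked (render u ++ special t ++ render (v ∷ʳ true))
marked-at t u v = subst Marked before (marked t (trues u) (u ++ true ∷ v) in-range)
  where
  before : mark t (trues u) ((u ++ true ∷ v) ∷ʳ true) ≡ render u ++ special t ++ render (v ∷ʳ true)
  before = trans (cong (mark t (trues u)) (++-assoc u (true ∷ v) [ true ])) (mark-++ t 0 u _)

  in-range : trues u < positions t ((u ++ true ∷ v) ∷ʳ true)
  -- Counting admissible slots as the `true` entries of a list ending in `t` treats both special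
  -- blocks at once.
  in-range = subst (trues u <_)
    (trans (cong trues (sym (++-assoc u (true ∷ v) [ t ]))) (trues-∷ʳ (u ++ true ∷ v) t))
    (trues-< u (v ∷ʳ t))

blocks-marked : ∀ {w} → Blocks w → EndsInNE⁺ w → Marked w
blocks-marked (blocks p s q) end with snocView q
blocks-marked (blocks {u} p nde q) end | empty = contradiction end (¬end-NDE u)
blocks-marked (blocks p nnee q) end | empty with u , refl ← [NE,D]*-render p =
  subst Marked (mark-++ true 0 u [ true ]) (marked true (trues u) u (trues-< u []))
blocks-marked (blocks {u} {b} p s q) end | ends-D {v} r =
  contradiction (subst EndsInNE⁺ (sym (trans (++-assoc u _ _) (cong (u ++_) (++-assoc b v _)))) end) (¬end-D _)
blocks-marked (blocks p s q) end | ends-NE r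
  with u , refl ← [NE,D]*-render p | v , refl ← [NE,D]*-render r | s
... | nnee = subst (λ w → Marked (render u ++ NNEE ++ w)) (render-++ v [ true ]) (marked-at true u v)
... | nde  = subst (λ w → Marked (render u ++ NDE ++ w)) (render-++ v [ true ]) (marked-at false u v)

-- The number of N steps fixes the number of admissible slots, and the number of N and D steps fixes
-- the number of blocks. So `c ∷ʳ t` has the length and the number of `true` entries of a descent
-- sequence for the hook shape.
Sch~₁-mark : ∀ {n e} (γ : Sch~₁ n e) → ∃₂ λ t p → ∃ λ c →
  word γ ≡ mark t p (c ∷ʳ true) × p < n ∸ suc e × trues (c ∷ʳ t) ≡ n ∸ suc e × suc (length (c ∷ʳ t)) ≡ n
Sch~₁-mark {n} {e} γ with word γ | blocks-marked (path-blocks (path γ)) (Sch~₁.endsInNE⁺ γ)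
                        | IsSchröder.norths (Sch~₁.isSchröder γ) | IsSchröder.diagonals (Sch~₁.isSchröder γ)
... | _ | marked t p c p< | norths | diagonals =
  t , p , c , refl , subst (p <_) positions≡ p< , trans (trues-∷ʳ c t) positions≡ , length≡
  where
  b = c ∷ʳ true

  p<trues : p < trues b
  p<trues = ≤-trans p< (positions≤trues t b)

  positions≡ : positions t b ≡ n ∸ suc e
  positions≡ = begin
    positions t b                        ≡⟨ m+n∸n≡m (positions t b) (suc e) ⟨
    positions t b + suc e ∸ suc e        ≡⟨ cong (_∸ suc e) (+-suc (positions t b) e) ⟩
    suc (positions t b) + e ∸ suc e      ≡⟨ cong (λ k → k + e ∸ suc e) (norths-mark t p b p<trues) ⟨
    count N (mark t p b) + e ∸ suc e     ≡⟨ cong (_∸ suc e) norths ⟩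
    n ∸ suc e                            ∎
    where open ≡-Reasoning

  length≡ : suc (length (c ∷ʳ t)) ≡ n
  length≡ = begin
    suc (length (c ∷ʳ t))                           ≡⟨ cong suc (trans (length-∷ʳ c t) (sym (length-∷ʳ c true))) ⟩
    suc (length b)                                  ≡⟨ size-mark t p b p<trues ⟨
    count N (mark t p b) + count D (mark t p b)     ≡⟨ cong (count N (mark t p b) +_) diagonals ⟩
    count N (mark t p b) + e                        ≡⟨ norths ⟩
    n                                               ∎
    where open ≡-Reasoning

-- Bijectivity of 𝒬 and the bounce formula

module _ (m e : ℕ) (1≤d : 1 ≤ suc e) (1≤K : 1 ≤ suc m ∸ e) where

  private
    n d K : ℕ
    -- Positive d and n - d force n ≥ 2; possible descents are then `suc m`, ..., 1.
    n = 2 + m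
    d = suc e
    K = n ∸ d

    d≤n : d ≤ n
    d≤n = <⇒≤ (m∸n≢0⇒n<m λ eq → contradiction (subst (1 ≤_) eq 1≤K) λ ())

    𝒬′ : SYT (hook n d) × Fin K → Sch~₁ n e
    𝒬′ = 𝒬 n d 1≤d 1≤K

    c : SYT (hook n d) → List Bool
    c τ = bits-init (descent? (rows τ)) m

    t : SYT (hook n d) → Bool
    t τ = does (descent? (rows τ) 1)

  bits-code : ∀ (τ : SYT (hook n d)) → descentBits (suc m) (rows τ) ≡ c τ ∷ʳ t τ
  bits-code τ = bits-∷ʳ (descent? (rows τ)) m

  Des-countdown : ∀ (τ : SYT (hook n d)) → Des τ ≡ filter (descent? (rows τ)) (countdown (suc m))
  Des-countdown τ = cong (λ s → filter (descent? (rows τ)) (countdown (s ∸ 1))) (sum-hook d≤n)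

  trues-bits : ∀ (τ : SYT (hook n d)) → trues (descentBits (suc m) (rows τ)) ≡ K
  trues-bits τ = begin
    trues (descentBits (suc m) (rows τ))                       ≡⟨ length-filter-bits (descent? (rows τ)) (suc m) ⟨
    length (filter (descent? (rows τ)) (countdown (suc m)))    ≡⟨ cong length (Des-countdown τ) ⟨
    des τ                                                      ≡⟨ des-hook 1≤d (s≤s z≤n) τ d≤n ⟩
    K                                                          ∎
    where open ≡-Reasoning

  positions-code : ∀ (τ : SYT (hook n d)) → positions (t τ) (c τ ∷ʳ true) ≡ K
  positions-code τ = trans (sym (trues-∷ʳ (c τ) (t τ))) (trans (cong trues (sym (bits-code τ))) (trues-bits τ))

  𝒮-mark : ∀ (τ : SYT (hook n d)) → word (𝒮 n d 1≤d 1≤K τ) ≡ mark (t τ) 0 (c τ ∷ʳ true)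
  𝒮-mark τ = begin
    word (𝒮 n d 1≤d 1≤K τ)                                ≡⟨ proj₂ (𝒮-γ n d 1≤d 1≤K τ) ⟩
    concatMap (γ-block (Des τ)) (countdown (suc m))       ≡⟨ cong (λ Ds → concatMap (γ-block Ds) (countdown (suc m))) (Des-countdown τ) ⟩
    concatMap (γ-block (filter (descent? (rows τ)) (countdown (suc m)))) (countdown (suc m))
                                                          ≡⟨ γ-blocks-mark (descent? (rows τ)) m (≤-trans 1≤K (≤-reflexive (sym (trues-bits τ)))) ⟩
    mark (t τ) 0 (c τ ∷ʳ true)                            ∎
    where open ≡-Reasoning

  𝒬-mark : ∀ (τ : SYT (hook n d)) i → word (𝒬′ (τ , i)) ≡ mark (t τ) (toℕ i) (c τ ∷ʳ true)
  𝒬-mark τ i = iterate-Π-mark (t τ) 0 (c τ ∷ʳ true) (toℕ i) (𝒮 n d 1≤d 1≤K τ)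
                 (𝒮-mark τ) (positions-code τ) (toℕ<n i)

  in-range : ∀ (τ : SYT (hook n d)) (i : Fin K) → toℕ i < trues (c τ ∷ʳ true)
  in-range τ i = ≤-trans (toℕ<n i)
    (≤-trans (≤-reflexive (sym (positions-code τ))) (positions≤trues (t τ) (c τ ∷ʳ true)))

  rows-determined : ∀ (τ τ′ : SYT (hook n d)) → descentBits (suc m) (rows τ) ≡ descentBits (suc m) (rows τ′) → rows τ ≡ rows τ′
  rows-determined τ τ′ eq
    with r , c , rows≡ , h ← SYT-isHook {d} {K} 1≤d τ | r′ , c′ , rows≡′ , h′ ← SYT-isHook {d} {K} 1≤d τ′ =
    trans rows≡ (trans (IsHook-unique (size h) (size h′)
      (trans (cong (descentBits (suc m)) (sym rows≡)) (trans eq (cong (descentBits (suc m)) rows≡′)))) (sym rows≡′))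
    where
    size : ∀ {r c} → IsHook (sum (hook n d)) r c → IsHook n r c
    size {r} {c} = subst (λ s → IsHook s r c) (sum-hook d≤n)

  -- The word yields the slot, which is `i`, all descent bits but the last, and through the kind of
  -- special block also the last one.
  𝒬-injective : Injective (Pointwise (_≡_ on rows {hook n d}) _≡_) (_≡_ on word) 𝒬′
  𝒬-injective {τ , i} {τ′ , i′} eq
    with t≡ , i≡ , c≡ ← mark-injective (t τ) (toℕ i) (c τ ∷ʳ true) (t τ′) (toℕ i′) (c τ′ ∷ʳ true)
                          (in-range τ i) (in-range τ′ i′)
                          (trans (sym (𝒬-mark τ i)) (trans eq (𝒬-mark τ′ i′))) =
    rows-determined τ τ′ (trans (bits-code τ) (trans (cong₂ _∷ʳ_ (∷ʳ-injectiveˡ _ _ c≡) t≡) (sym (bits-code τ′)))) ,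
    toℕ-injective i≡

  𝒬-surjective : Surjective (Pointwise (_≡_ on rows {hook n d}) _≡_) (_≡_ on word) 𝒬′
  𝒬-surjective γ with t₀ , p , c₀ , word≡ , p<K , trues≡ , length≡ ← Sch~₁-mark γ =
    (τ , fromℕ< p<K) , λ {z} → hits {z}
    where
    -- The descent sequence of the preimage: the code of the path, with its last entry replaced by
    -- the kind of special block.
    b = c₀ ∷ʳ t₀

    τ : SYT (hook n d)
    τ = hookSYT b (trans (m+[n∸m]≡n d≤n) (sym length≡)) trues≡

    open ≡-Reasoning

    code : ∀ (τ′ : SYT (hook n d)) → rows τ′ ≡ rows τ → c τ′ ∷ʳ t τ′ ≡ b
    code τ′ rows≡ = begin
      c τ′ ∷ʳ t τ′                            ≡⟨ bits-code τ′ ⟨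
      descentBits (suc m) (rows τ′)           ≡⟨ cong₂ descentBits (sym (suc-injective length≡)) rows≡ ⟩
      descentBits (length b) (hookRows b)     ≡⟨ bits-hookRows b ⟩
      b                                       ∎

    -- `Surjective` asks this of every pair equivalent to the chosen one, that is, of every tableau
    -- with the same rows.
    hits : ∀ {z} → Pointwise (_≡_ on rows) _≡_ z (τ , fromℕ< p<K) → word (𝒬′ z) ≡ word γ
    hits {τ′ , _} (rows≡ , refl) with c≡ , t≡ ← ∷ʳ-injective (c τ′) c₀ (code τ′ rows≡) = begin
      word (𝒬′ (τ′ , fromℕ< p<K))                       ≡⟨ 𝒬-mark τ′ (fromℕ< p<K) ⟩
      mark (t τ′) (toℕ (fromℕ< p<K)) (c τ′ ∷ʳ true)     ≡⟨ cong₂ (λ t c → mark t (toℕ (fromℕ< p<K)) (c ∷ʳ true)) t≡ c≡ ⟩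
      mark t₀ (toℕ (fromℕ< p<K)) (c₀ ∷ʳ true)           ≡⟨ cong (λ p → mark t₀ p (c₀ ∷ʳ true)) (toℕ-fromℕ< p<K) ⟩
      mark t₀ p (c₀ ∷ʳ true)                            ≡⟨ word≡ ⟨
      word γ                                            ∎

  maj∸des : ∀ (τ : SYT (hook n d)) → maj τ ∸ des τ ≡ weight (c τ ∷ʳ true)
  maj∸des τ = begin
    maj τ ∸ des τ                                              ≡⟨ cong (λ Ds → sum Ds ∸ length Ds) (Des-countdown τ) ⟩
    sum Ds ∸ length Ds                                         ≡⟨ cong (_∸ length Ds) (sum-filter (descent? (rows τ)) (suc m)) ⟩
    weight (descentBits (suc m) (rows τ)) + length Ds ∸ length Ds ≡⟨ m+n∸n≡m _ (length Ds) ⟩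
    weight (descentBits (suc m) (rows τ))                      ≡⟨ cong weight (bits-code τ) ⟩
    weight (c τ ∷ʳ t τ)                                        ≡⟨ weight-∷ʳ (c τ) (t τ) ⟩
    weight (c τ ∷ʳ true)                                       ∎
    where
    open ≡-Reasoning
    Ds = filter (descent? (rows τ)) (countdown (suc m))

  𝒬-bounce : ∀ (τ : SYT (hook n d)) i → bounce (word (𝒬′ (τ , i))) ≡ (maj τ ∸ des τ) + toℕ i
  𝒬-bounce τ i = begin
    bounce (word (𝒬′ (τ , i)))                        ≡⟨ cong bounce (𝒬-mark τ i) ⟩
    bounce (mark (t τ) (toℕ i) (c τ ∷ʳ true))         ≡⟨ bounce-mark (t τ) (toℕ i) (c τ ∷ʳ true) (in-range τ i) ⟩
    weight (c τ ∷ʳ true) + toℕ i                      ≡⟨ cong (_+ toℕ i) (maj∸des τ) ⟨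
    (maj τ ∸ des τ) + toℕ i                           ∎
    where open ≡-Reasoning

proposition9 : ∀ (n d : ℕ) → 1 ≤ n → (1≤d : 1 ≤ d) (1≤n∸d : 1 ≤ n ∸ d) →
    Bijective (Pointwise (_≡_ on rows) _≡_) (_≡_ on word) (𝒬 n d 1≤d 1≤n∸d)
    × (∀ (τ : SYT (hook n d)) (i : Fin (n ∸ d)) → toℕ i < n ∸ d ∸ 1 →
    bounce (word (𝒬 n d 1≤d 1≤n∸d (τ , i))) ≡ (maj τ ∸ des τ) + toℕ i)
proposition9 (suc zero)    (suc e) _ 1≤d 1≤n∸d =
  contradiction (subst (1 ≤_) (0∸n≡0 e) 1≤n∸d) λ ()
proposition9 (suc (suc m)) (suc e) _ 1≤d 1≤n∸d =
  ((λ {x} {y} → 𝒬-injective m e 1≤d 1≤n∸d {x} {y}) , 𝒬-surjective m e 1≤d 1≤n∸d) , λ τ i _ → 𝒬-bounce m e 1≤d 1≤n∸d τ i
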